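{- Let $(A,B)$ be an interpolation problem. Let $a+b\le c$ be a mixed literal with auxiliary variable $x_2$, and let $x_1$ be the auxiliary variable of the negated literal $\lnot(a+b\le c)$. Suppose that $I_1[LA(c_1x_1+s_1(\vec x),k_1,F_1(x_1,\vec x))]$ is a partial interpolant of the clause $C_1\lor a+b\le c$ and that $I_2[LA(c_2x_2+s_2(\vec x),k_2,F_2(x_2,\vec x))]$ is a partial interpolant of the clause $C_2\lor\lnot(a+b\le c)$, where the displayed $LA$-sub-formulae occur only positively, $x_1$ (respectively $x_2$) occurs in the first (respectively second) partial interpolant only inside the displayed $LA$-sub-formula, and $\vec x$ denotes the other auxiliary variables of mixed inequality literals. Let $$s_3(\vec x):=c_2s_1(\vec x)+c_1s_2(\vec x).$$ In the integer case let $k_3:=c_2k_1+c_1k_2+c_1c_2$ and $$F_3(\vec x):\equiv\bigvee_{i=0}^{\left\lceil\frac{k_1+1}{c_1}\right\rceil}F_1\!\left(\left\lfloor\tfrac{ -s_1(\vec x)}{c_1}\right\rfloor-i,\vec x\right)\land F_2\!\left(i-\left\lfloor\tfrac{ -s_1(\vec x)}{c_1}\right\rfloor,\vec x\right).$$ In the real case let, if $k_1=-\varepsilon$, $k_3:=k_2$ and $F_3(\vec x):\equiv F_2\!\left(\tfrac{s_1(\vec x)}{c_1},\vec x\right)$; and, if $k_1=0$, $k_3:=0$ and $F_3(\vec x):\equiv s_3(\vec x)<0\lor\left(F_1\!\left(-\tfrac{s_1(\vec x)}{c_1},\vec x\right)\land F_2\!\left(\tfrac{s_1(\vec x)}{c_1},\vec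 x\right)\right)$. Then $I_1[I_2[LA(s_3(\vec x),k_3,F_3(\vec x))]]$ is a partial interpolant of the clause $C_1\lor C_2$.
   Context: Formulae are quantifier-free first-order formulae in the combined theory of equality with uninterpreted functions and linear arithmetic over $\mathbb{Q}$ and $\mathbb{Z}$ (with the integer division-by-constant functions $\lfloor\cdot/k\rfloor$, $k\ge 1$, in the signature); $\models$ is entailment in this theory. $\mathrm{symb}(F)$ is the set of non-theory symbols of $F$. An interpolation problem is a pair $(A,B)$ of formulae with $A\land B\models\bot$. A symbol is shared if it is in $\mathrm{symb}(A)\cap\mathrm{symb}(B)$, $A$-local if in $\mathrm{symb}(A)\setminus\mathrm{symb}(B)$, $B$-local if in $\mathrm{symb}(B)\setminus\mathrm{symb}(A)$. A term/literal is $A$-local ($B$-local) if it contains at least one $A$-local ($B$-local) symbol and no $B$-local ($A$-local) symbol, shared if it contains only shared symbols, mixed if it contains both $A$-local and $B$-local symbols. Arithmetic. In the integer case all variables and terms are integer-valued, inequality literals are $s\le c$ with $s$ a linear combination with integer coefficients and $c\in\mathbb{Z}$, and $s<c$ means $s\le c-1$. In the real case variables range over $\mathbb{Q}$ and constants over $\mathbb{Q}_\varepsilon=\mathbb{Q}\cup\{q-\varepsilon\mid q\in\mathbb{Q}\}$, where $s\le q-\varepsilon$ means $s<q$; accordingly "$s<\varepsilon$" means $s\le 0$. In the integer case $-\varepsilon$ stands for $-1$. For readability, $s > 0$, $s<-k$ etc. are used in this sense. Projections. Each literal $\ell$ has projections $\ell\downharpoonright A$, $\ell\downharpoonright B$,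 extended to conjunctions of literals component-wise. For non-mixed literals: if $\ell$ is $A$-local, $\ell\downharpoonright A=\ell$ and $\ell\downharpoonright B=\top$; if $\ell$ is $B$-local, $\ell\downharpoonright A=\top$ and $\ell\downharpoonright B=\ell$; if $\ell$ is shared, then either (Pudlák) $\ell\downharpoonright A=\ell\downharpoonright B=\ell$, or (McMillan) $\ell\downharpoonright A=\top$, $\ell\downharpoonright B=\ell$, the choice being fixed throughout. For mixed literals, fresh auxiliary variables are used: for $a$ $A$-local and $b$ $B$-local, $(a=b)\downharpoonright A := (a=x)$, $(a=b)\downharpoonright B := (x=b)$, $(a\neq b)\downharpoonright A := (p_x \mathrel{\mathrm{xor}} (a=x))$, $(a\neq b)\downharpoonright B := (\lnot p_x \mathrel{\mathrm{xor}} (x=b))$ ($p_x$ Boolean); for a mixed inequality $a+b\le c$, where $a$ is a linear combination of $A$-local variables, $b$ a linear combination of $B$-local and shared variables and $c$ a constant, with auxiliary variable $x$: $(a+b\le c)\downharpoonright A := (a+x\le 0)$ and $(a+b\le c)\downharpoonright B := (-x+b\le c)$. The negation of a mixed inequality is again a mixed inequality and has a different auxiliary variable. Thus for the pivot here: $(a+b\le c)\downharpoonright A=(a+x_2\le0)$, $(a+b\le c)\downharpoonright B=(-x_2+b\le c)$, $\lnot(a+b\le c)\downharpoonright A=(-a+x_1\le0)$, $\lnot(a+b\le c)\downharpoonright B=(-x_1-b<-c)$, i.e. $\lnot(x_1+b\le c)$. Auxiliary variables belonging to different literals are distinct (except that $a=b$ and $a\ne b$ share $x$), are fresh (do not occur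 in $A$, $B$ or the clauses), have the same type as the terms in the literal, and count as shared symbols. Partial interpolant. A partial interpolant of a clause $C$ is a formula $I$ that is an interpolant of $A\land(\lnot C\downharpoonright A)$ and $B\land(\lnot C\downharpoonright B)$, i.e. (i) $A\land\lnot C\downharpoonright A\models I$, (ii) $B\land\lnot C\downharpoonright B\land I\models\bot$, (iii) every non-theory symbol of $I$ is in $\mathrm{symb}(A)\cap\mathrm{symb}(B)$ or is an auxiliary variable introduced by the projections of the literals of $\lnot C$. $LA$-pattern. The expression $LA(s(\vec y),k,F(\vec y))$, where $\vec y$ is a vector of auxiliary variables, denotes the formula $F(\vec y)$ and merely records $s$ and $k$. It is only used when: $s$ is a linear term over $\vec y$ and arbitrary other terms not involving $\vec y$, in which the coefficients of the variables $\vec y$ are positive (so in particular $c_1,c_2>0$); $k\in\{0,-\varepsilon\}$ in the real case and $k\in\mathbb{Z}$, $k\ge-1$ in the integer case; $F$ is monotone, i.e. $\vec y\ge\vec y'$ (component-wise) implies $F(\vec y)\rightarrow F(\vec y')$; $F(\vec y)=\bot$ whenever $s(\vec y)>0$; and $F(\vec y)=\top$ whenever $s(\vec y)<-k$. In a partial interpolant, auxiliary variables of mixed inequality literals occur only inside such $LA$-sub-formulae. $F[G]$ denotes a formula in negation normal form with a sub-formula $G$ occurring positively; $F[G']$ is the result of replacing $G$ by $G'$. $C_1,C_2$ contain neither the pivot literal nor its negation. -}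

module Defs where

open import Data.Bool using (Bool; true; false)
open import Data.Empty using (⊥)
open import Data.Integer as ℤ using (ℤ; +_; ∣_∣; 0ℤ; 1ℤ; -1ℤ)
import Data.Integer.DivMod as ℤ
open import Data.List using (List; []; _∷_; _++_; map; foldr; concatMap; filter; upTo)
open import Data.List.Membership.Propositional using (_∈_; _∉_)
import Data.List.Membership.DecPropositional as DecMembership
open import Data.List.Relation.Unary.All using (All; []; _∷_)
open import Data.List.Relation.Unary.Any using (Any; any?)
open import Data.Maybe using (Maybe; just; nothing; maybe)
open import Data.Nat as ℕ using (ℕ; suc)
open import Data.Product using (_×_; _,_; proj₁; proj₂)
open import Data.Rational as ℚ using (ℚ; 0ℚ; 1ℚ)
import Data.Rational.Properties as ℚ
open import Data.Sum using (_⊎_)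
open import Data.Unit using (⊤)
open import Relation.Binary.Definitions using (DecidableEquality)
open import Relation.Binary.PropositionalEquality using (_≡_; refl)
open import Relation.Nullary using (¬_; Dec; yes; no; ¬?; _×-dec_)

data NumSort : Set where
  int real : NumSort

Num : NumSort → Set
Num int  = ℤ
Num real = ℚ

0# 1# : ∀ {ν} → Num ν
0# {int}  = 0ℤ
0# {real} = 0ℚ
1# {int}  = 1ℤ
1# {real} = 1ℚ

infixl 6 _+#_
infixl 7 _*#_
infix  8 -#_
infix  4 _≤#_ _<#_

_+#_ _*#_ : ∀ {ν} → Num ν → Num ν → Num ν
_+#_ {int}  = ℤ._+_
_+#_ {real} = ℚ._+_
_*#_ {int}  = ℤ._*_
_*#_ {real} = ℚ._*_

-#_ : ∀ {ν} → Num ν → Num ν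
-#_ {int}  = ℤ.-_
-#_ {real} = ℚ.-_

_≤#_ _<#_ : ∀ {ν} → Num ν → Num ν → Set
_≤#_ {int}  = ℤ._≤_
_≤#_ {real} = ℚ._≤_
_<#_ {int}  = ℤ._<_
_<#_ {real} = ℚ._<_

Positive : ∀ {ν} → Num ν → Set
Positive {int}  = ℤ.Positive
Positive {real} = ℚ.Positive

∣pos∣-nonZero : ∀ c → ℤ.Positive c → ℕ.NonZero ∣ c ∣
∣pos∣-nonZero (+ suc _) _ = _

⌈_/_⌉ : ℤ → (d : ℕ) .{{_ : ℕ.NonZero d}} → ℤ
⌈ n / d ⌉ = ℤ.- ((ℤ.- n) ℤ./ℕ d)

-- ℚ ∪ { q - ε ∣ q ∈ ℚ }
data ℚε : Set where
  std     : ℚ → ℚε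
  _minusε : ℚ → ℚε

Bound : NumSort → Set
Bound int  = ℤ
Bound real = ℚε

infix 4 _≤ᵇ_

_≤ᵇ_ : ∀ {ν} → Num ν → Bound ν → Set
_≤ᵇ_ {int}  v c          = v ℤ.≤ c
_≤ᵇ_ {real} v (std q)    = v ℚ.≤ q
_≤ᵇ_ {real} v (q minusε) = v ℚ.< q

0ᵇ : ∀ {ν} → Bound ν
0ᵇ {int}  = 0ℤ
0ᵇ {real} = std 0ℚ

-- The bound - ε, which is - 1 over the integers: v ≤ᵇ -ε says v < 0.
-ε : ∀ {ν} → Bound ν
-ε {int}  = -1ℤ
-ε {real} = 0ℚ minusε

-- c ↦ - c - ε, so that ¬ (v ≤ᵇ c) iff - v ≤ᵇ complement c.
complement : ∀ {ν} → Bound ν → Bound ν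
complement {int}  c          = ℤ.- c ℤ.- 1ℤ
complement {real} (std q)    = (ℚ.- q) minusε
complement {real} (q minusε) = std (ℚ.- q)

data RealSlack : Set where
  k=0 k=-ε : RealSlack

Slack : NumSort → Set
Slack int  = ℤ
Slack real = RealSlack

AdmissibleSlack : ∀ {ν} → Slack ν → Set
AdmissibleSlack {int}  k = -1ℤ ℤ.≤ k
AdmissibleSlack {real} _ = ⊤

-- v <-slack k is v < - k; for k = - ε this is v < ε, i.e. v ≤ 0.
_<-slack_ : ∀ {ν} → Num ν → Slack ν → Set
_<-slack_ {int}  v k    = v ℤ.< ℤ.- k
_<-slack_ {real} v k=0  = v ℚ.< 0ℚ
_<-slack_ {real} v k=-ε = v ℚ.≤ 0ℚ

data Sort (U : Set) : Set where
  num  : NumSort → Sort U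
  bool : Sort U
  unin : U → Sort U

record Signature : Set₁ where
  field
    USort  : Set
    Fn     : Set
    arity  : Fn → List (Sort USort)
    result : Fn → Sort USort
    -- A variable is a name together with a sort.
    Name   : Set
    _≟ᵁ_   : DecidableEquality USort
    _≟ᶠ_   : DecidableEquality Fn
    _≟ᴺ_   : DecidableEquality Name

data SharedMode : Set where
  pudlák mcMillan : SharedMode

data Side : Set where
  A-side B-side : Side

data Locality : Set where
  A-local B-local shared mixed : Locality

-- Negation normal forms over literals L, with extra positive leaves P.
infixr 6 _∧ⁿ_
infixr 5 _∨ⁿ_

data NNF (L P : Set) : Set where
  lit       : L → NNF L P
  ⊤ⁿ ⊥ⁿ     : NNF L P
  _∧ⁿ_ _∨ⁿ_ : NNF L P → NNF L P → NNF L P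
  leaf      : P → NNF L P

module _ {L P : Set} where

  lits : NNF L P → List L
  lits (lit ℓ)  = ℓ ∷ []
  lits ⊤ⁿ       = []
  lits ⊥ⁿ       = []
  lits (φ ∧ⁿ ψ) = lits φ ++ lits ψ
  lits (φ ∨ⁿ ψ) = lits φ ++ lits ψ
  lits (leaf _) = []

  leaves : NNF L P → List P
  leaves (lit _)  = []
  leaves ⊤ⁿ       = []
  leaves ⊥ⁿ       = []
  leaves (φ ∧ⁿ ψ) = leaves φ ++ leaves ψ
  leaves (φ ∨ⁿ ψ) = leaves φ ++ leaves ψ
  leaves (leaf p) = p ∷ []

  -- Filling the holes `leaf nothing` of a context.
  _[_] : NNF L (Maybe P) → NNF L P → NNF L P
  lit ℓ         [ χ ] = lit ℓ
  ⊤ⁿ            [ χ ] = ⊤ⁿ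
  ⊥ⁿ            [ χ ] = ⊥ⁿ
  (φ ∧ⁿ ψ)      [ χ ] = (φ [ χ ]) ∧ⁿ (ψ [ χ ])
  (φ ∨ⁿ ψ)      [ χ ] = (φ [ χ ]) ∨ⁿ (ψ [ χ ])
  leaf (just p) [ χ ] = leaf p
  leaf nothing  [ χ ] = χ

HasHole : ∀ {L P} → NNF L (Maybe P) → Set
HasHole φ = nothing ∈ leaves φ

⋁ⁿ : ∀ {L P} → List (NNF L P) → NNF L P
⋁ⁿ = foldr _∨ⁿ_ ⊥ⁿ

module Logic (S : Signature) where

  open Signature S public

  𝕊 : Set
  𝕊 = Sort USort

  _≟ⁿˢ_ : DecidableEquality NumSort
  int  ≟ⁿˢ int  = yes refl
  int  ≟ⁿˢ real = no λ ()
  real ≟ⁿˢ int  = no λ ()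
  real ≟ⁿˢ real = yes refl

  _≟ˢ_ : DecidableEquality 𝕊
  num ν ≟ˢ num μ with ν ≟ⁿˢ μ
  ... | yes refl = yes refl
  ... | no ν≢μ   = no λ { refl → ν≢μ refl }
  num _  ≟ˢ bool   = no λ ()
  num _  ≟ˢ unin _ = no λ ()
  bool   ≟ˢ num _  = no λ ()
  bool   ≟ˢ bool   = yes refl
  bool   ≟ˢ unin _ = no λ ()
  unin _ ≟ˢ num _  = no λ ()
  unin _ ≟ˢ bool   = no λ ()
  unin u ≟ˢ unin w with u ≟ᵁ w
  ... | yes refl = yes refl
  ... | no u≢w   = no λ { refl → u≢w refl }

  data Sym : Set where
    fun : Fn → Sym
    var : 𝕊 → Name → Sym

  _≟ʸ_ : DecidableEquality Sym
  fun f   ≟ʸ fun g with f ≟ᶠ g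
  ... | yes refl = yes refl
  ... | no f≢g   = no λ { refl → f≢g refl }
  fun _   ≟ʸ var _ _ = no λ ()
  var _ _ ≟ʸ fun _   = no λ ()
  var σ x ≟ʸ var τ y with σ ≟ˢ τ | x ≟ᴺ y
  ... | yes refl | yes refl = yes refl
  ... | no σ≢τ   | _        = no λ { refl → σ≢τ refl }
  ... | yes _    | no x≢y   = no λ { refl → x≢y refl }

  data Term : 𝕊 → Set where
    var   : ∀ {σ} → Name → Term σ
    app   : (f : Fn) → All Term (arity f) → Term (result f)
    const : ∀ {ν} → Num ν → Term (num ν)
    _⊕_   : ∀ {ν} → Term (num ν) → Term (num ν) → Term (num ν)
    _⊙_   : ∀ {ν} → Num ν → Term (num ν) → Term (num ν)
    ⌊_÷_⌋ : Term (num int) → (k : ℕ) .{{_ : ℕ.NonZero k}} → Term (num int)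

  infixl 6 _⊕_
  infixr 7 _⊙_

  data IsVar {σ : 𝕊} : Term σ → Set where
    var : ∀ x → IsVar (var x)

  ⊖_ : ∀ {ν} → Term (num ν) → Term (num ν)
  ⊖ t = (-# 1#) ⊙ t

  -- Linear combinations; a constant summand is a multiple of `const 1#`.
  Monomial : NumSort → Set
  Monomial ν = Num ν × Term (num ν)

  Lin : NumSort → Set
  Lin ν = List (Monomial ν)

  infixr 7 _·_

  _·_ : ∀ {ν} → Num ν → Lin ν → Lin ν
  c · s = map (λ m → c *# proj₁ m , proj₂ m) s

  ⌜_⌝ : ∀ {ν} → Lin ν → Term (num ν)
  ⌜ s ⌝ = foldr (λ m t → proj₁ m ⊙ proj₂ m ⊕ t) (const 0#) s

  infix 4 _≦_

  record Ineq (ν : NumSort) : Set where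
    constructor _≦_
    field
      lhs   : Lin ν
      bound : Bound ν

  negIneq : ∀ {ν} → Ineq ν → Ineq ν
  negIneq (s ≦ c) = (-# 1#) · s ≦ complement c

  data Literal : Set where
    eq neq  : ∀ {σ} → Term σ → Term σ → Literal
    ineq    : ∀ {ν} → Ineq ν → Literal
    pos neg : Term bool → Literal

  ∼_ : Literal → Literal
  ∼ eq t u  = neq t u
  ∼ neq t u = eq t u
  ∼ ineq ι  = ineq (negIneq ι)
  ∼ pos t   = neg t
  ∼ neg t   = pos t

  Clause : Set
  Clause = List Literal

  infixr 6 _∧ᶠ_
  infixr 5 _∨ᶠ_ _xorᶠ_

  data Formula : Set where
    lit       : Literal → Formula
    ⊤ᶠ ⊥ᶠ     : Formula
    ¬ᶠ_       : Formula → Formula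
    _∧ᶠ_ _∨ᶠ_ : Formula → Formula → Formula

  _xorᶠ_ : Formula → Formula → Formula
  φ xorᶠ ψ = (φ ∧ᶠ (¬ᶠ ψ)) ∨ᶠ ((¬ᶠ φ) ∧ᶠ ψ)

  ⋀ᶠ : List Formula → Formula
  ⋀ᶠ = foldr _∧ᶠ_ ⊤ᶠ

  Plain : Set
  Plain = NNF Literal ⊥

  record LA : Set where
    constructor mkLA
    field
      {sort} : NumSort
      s      : Lin sort
      k      : Slack sort
      F      : Plain

  Interpolant : Set
  Interpolant = NNF Literal LA

  Context : Set
  Context = NNF Literal (Maybe LA)

  toFormula : ∀ {P} → (P → Formula) → NNF Literal P → Formula
  toFormula f (lit ℓ)  = lit ℓ
  toFormula f ⊤ⁿ       = ⊤ᶠ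
  toFormula f ⊥ⁿ       = ⊥ᶠ
  toFormula f (φ ∧ⁿ ψ) = toFormula f φ ∧ᶠ toFormula f ψ
  toFormula f (φ ∨ⁿ ψ) = toFormula f φ ∨ᶠ toFormula f ψ
  toFormula f (leaf p) = f p

  plain : Plain → Formula
  plain = toFormula λ ()

  ⟪_⟫ : Interpolant → Formula
  ⟪_⟫ = toFormula λ π → plain (LA.F π)

  mutual
    symbᵗ : ∀ {σ} → Term σ → List Sym
    symbᵗ (var {σ} x) = var σ x ∷ []
    symbᵗ (app f ts)  = fun f ∷ symbᵗˢ ts
    symbᵗ (const _)   = []
    symbᵗ (t ⊕ u)     = symbᵗ t ++ symbᵗ u
    symbᵗ (_ ⊙ t)     = symbᵗ t
    symbᵗ ⌊ t ÷ _ ⌋   = symbᵗ t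

    symbᵗˢ : ∀ {σs} → All Term σs → List Sym
    symbᵗˢ []       = []
    symbᵗˢ (t ∷ ts) = symbᵗ t ++ symbᵗˢ ts

  symbᵐ : ∀ {ν} → Monomial ν → List Sym
  symbᵐ m = symbᵗ (proj₂ m)

  symbˢ : ∀ {ν} → Lin ν → List Sym
  symbˢ = concatMap symbᵐ

  symbˡ : Literal → List Sym
  symbˡ (eq t u)       = symbᵗ t ++ symbᵗ u
  symbˡ (neq t u)      = symbᵗ t ++ symbᵗ u
  symbˡ (ineq (s ≦ _)) = symbˢ s
  symbˡ (pos t)        = symbᵗ t
  symbˡ (neg t)        = symbᵗ t

  symb : Formula → List Sym
  symb (lit ℓ)  = symbˡ ℓ
  symb ⊤ᶠ       = []
  symb ⊥ᶠ       = []
  symb (¬ᶠ φ)   = symb φ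
  symb (φ ∧ᶠ ψ) = symb φ ++ symb ψ
  symb (φ ∨ᶠ ψ) = symb φ ++ symb ψ

  symbⁿ : ∀ {P} → (P → List Sym) → NNF Literal P → List Sym
  symbⁿ f φ = concatMap symbˡ (lits φ) ++ concatMap f (leaves φ)

  symbᵖ : Plain → List Sym
  symbᵖ = symbⁿ λ ()

  -- The recorded linear term is part of an LA-expression, so its symbols count.
  symbᴸᴬ : LA → List Sym
  symbᴸᴬ (mkLA s _ F) = symbˢ s ++ symbᵖ F

  symbⁱ : Interpolant → List Sym
  symbⁱ = symbⁿ symbᴸᴬ

  symbᶜ : Context → List Sym
  symbᶜ = symbⁿ (maybe symbᴸᴬ [])

  module Substitution {σ : 𝕊} (x : Name) (r : Term σ) where
    mutual
      substᵗ : ∀ {τ} → Term τ → Term τ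
      substᵗ (var {τ} y) with σ ≟ˢ τ | x ≟ᴺ y
      ... | yes refl | yes _ = r
      ... | yes refl | no _  = var y
      ... | no _     | _     = var y
      substᵗ (app f ts) = app f (substᵗˢ ts)
      substᵗ (const c)  = const c
      substᵗ (t ⊕ u)    = substᵗ t ⊕ substᵗ u
      substᵗ (c ⊙ t)    = c ⊙ substᵗ t
      substᵗ ⌊ t ÷ k ⌋  = ⌊ substᵗ t ÷ k ⌋

      substᵗˢ : ∀ {τs} → All Term τs → All Term τs
      substᵗˢ []       = []
      substᵗˢ (t ∷ ts) = substᵗ t ∷ substᵗˢ ts

    substˡ : Literal → Literal
    substˡ (eq t u)       = eq (substᵗ t) (substᵗ u)
    substˡ (neq t u)      = neq (substᵗ t) (substᵗ u)
    substˡ (ineq (s ≦ c)) = ineq (map (λ m → proj₁ m , substᵗ (proj₂ m)) s ≦ c)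
    substˡ (pos t)        = pos (substᵗ t)
    substˡ (neg t)        = neg (substᵗ t)

    substᵖ : Plain → Plain
    substᵖ (lit ℓ)  = lit (substˡ ℓ)
    substᵖ ⊤ⁿ       = ⊤ⁿ
    substᵖ ⊥ⁿ       = ⊥ⁿ
    substᵖ (φ ∧ⁿ ψ) = substᵖ φ ∧ⁿ substᵖ ψ
    substᵖ (φ ∨ⁿ ψ) = substᵖ φ ∨ⁿ substᵖ ψ

  _⟨_≔_⟩ : ∀ {σ} → Plain → Name → Term σ → Plain
  F ⟨ x ≔ r ⟩ = Substitution.substᵖ x r F

  Value : (USort → Set) → 𝕊 → Set
  Value Carrier (num ν)  = Num ν
  Value Carrier bool     = Bool
  Value Carrier (unin u) = Carrier u

  -- Decidable equality on the carriers makes truth of formulae decidable,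
  -- so the connectives have their classical meaning.
  record Structure : Set₁ where
    field
      Carrier : USort → Set
      element : ∀ u → Carrier u
      _≟ᶜ_    : ∀ {u} → DecidableEquality (Carrier u)
      ⟦_⟧ᶠ    : (f : Fn) → All (Value Carrier) (arity f) → Value Carrier (result f)

    ⟦_⟧ˢ : 𝕊 → Set
    ⟦_⟧ˢ = Value Carrier

  Valuation : Structure → Set
  Valuation M = ∀ σ → Name → Structure.⟦_⟧ˢ M σ

  module _ (M : Structure) where
    open Structure M

    mutual
      evalᵗ : ∀ {σ} → Valuation M → Term σ → ⟦ σ ⟧ˢ
      evalᵗ ρ (var {σ} x) = ρ σ x
      evalᵗ ρ (app f ts)  = ⟦ f ⟧ᶠ (evalᵗˢ ρ ts)
      evalᵗ ρ (const c)   = c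
      evalᵗ ρ (t ⊕ u)     = evalᵗ ρ t +# evalᵗ ρ u
      evalᵗ ρ (c ⊙ t)     = c *# evalᵗ ρ t
      evalᵗ ρ ⌊ t ÷ k ⌋   = evalᵗ ρ t ℤ./ℕ k

      evalᵗˢ : ∀ {σs} → Valuation M → All Term σs → All ⟦_⟧ˢ σs
      evalᵗˢ ρ []       = []
      evalᵗˢ ρ (t ∷ ts) = evalᵗ ρ t ∷ evalᵗˢ ρ ts

    evalˢ : ∀ {ν} → Valuation M → Lin ν → Num ν
    evalˢ ρ s = evalᵗ ρ ⌜ s ⌝

    holdsˡ : Valuation M → Literal → Set
    holdsˡ ρ (eq t u)       = evalᵗ ρ t ≡ evalᵗ ρ u
    holdsˡ ρ (neq t u)      = ¬ (evalᵗ ρ t ≡ evalᵗ ρ u)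
    holdsˡ ρ (ineq (s ≦ c)) = evalˢ ρ s ≤ᵇ c
    holdsˡ ρ (pos t)        = evalᵗ ρ t ≡ true
    holdsˡ ρ (neg t)        = evalᵗ ρ t ≡ false

    holds : Valuation M → Formula → Set
    holds ρ (lit ℓ)  = holdsˡ ρ ℓ
    holds ρ ⊤ᶠ       = ⊤
    holds ρ ⊥ᶠ       = ⊥
    holds ρ (¬ᶠ φ)   = ¬ holds ρ φ
    holds ρ (φ ∧ᶠ ψ) = holds ρ φ × holds ρ ψ
    holds ρ (φ ∨ᶠ ψ) = holds ρ φ ⊎ holds ρ ψ

  infix 3 _⊨_

  _⊨_ : Formula → Formula → Set₁
  φ ⊨ ψ = ∀ (M : Structure) (ρ : Valuation M) → holds M ρ φ → holds M ρ ψ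

  -- The mixed literals t = u and t ≠ u, where t is the A-local and u the
  -- B-local side, share the variable of `eqKey t u`; `neqKey t u` is for p_x.
  data AuxKey : 𝕊 → Set where
    eqKey   : ∀ {σ} → Term σ → Term σ → AuxKey σ
    neqKey  : ∀ {σ} → Term σ → Term σ → AuxKey bool
    ineqKey : ∀ {ν} → Ineq ν → AuxKey (num ν)

  record AuxNaming : Set where
    field
      aux           : ∀ {σ} → AuxKey σ → Name
      aux-injective : ∀ {σ} {κ κ′ : AuxKey σ} → aux κ ≡ aux κ′ → κ ≡ κ′

  s₃ : ∀ {ν} → Num ν → Num ν → Lin ν → Lin ν → Lin ν
  s₃ c₁ c₂ s₁ s₂ = c₂ · s₁ ++ c₁ · s₂

  k₃ : ∀ {ν} → Num ν → Num ν → Slack ν → Slack ν → Slack ν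
  k₃ {int}  c₁ c₂ k₁   k₂ = c₂ ℤ.* k₁ ℤ.+ c₁ ℤ.* k₂ ℤ.+ c₁ ℤ.* c₂
  k₃ {real} c₁ c₂ k=-ε k₂ = k₂
  k₃ {real} c₁ c₂ k=0  k₂ = k=0

  -- F₁ and F₂ are given as functions of the term put for x₁ and x₂.
  F₃ : ∀ {ν} (c₁ c₂ : Num ν) → Positive c₁ → (s₁ s₂ : Lin ν) → Slack ν →
       (F₁ F₂ : Term (num ν) → Plain) → Plain
  F₃ {int} c₁ c₂ c₁>0 s₁ s₂ k₁ F₁ F₂ =
    ⋁ⁿ (map (λ i → F₁ (q ⊕ ⊖ const (+ i)) ∧ⁿ F₂ (const (+ i) ⊕ ⊖ q))
            (upTo (suc ∣ ⌈ k₁ ℤ.+ 1ℤ / ∣ c₁ ∣ ⌉ ∣)))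
    where
    instance
      c₁≢0 : ℕ.NonZero ∣ c₁ ∣
      c₁≢0 = ∣pos∣-nonZero c₁ c₁>0
    q : Term (num int)
    q = ⌊ ⊖ ⌜ s₁ ⌝ ÷ ∣ c₁ ∣ ⌋
  F₃ {real} c₁ c₂ c₁>0 s₁ s₂ k₁ F₁ F₂ = byCases k₁
    where
    s₁/c₁ : Term (num real)
    s₁/c₁ = (ℚ.1/ c₁) {{ℚ.pos⇒nonZero c₁ {{c₁>0}}}} ⊙ ⌜ s₁ ⌝
    byCases : RealSlack → Plain
    byCases k=-ε = F₂ s₁/c₁
    byCases k=0  = lit (ineq (s₃ c₁ c₂ s₁ s₂ ≦ -ε)) ∨ⁿ (F₁ (⊖ s₁/c₁) ∧ⁿ F₂ s₁/c₁)

module Interpolation (S : Signature) (N : Logic.AuxNaming S) (mode : SharedMode)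
                     (A B : Logic.Formula S) where

  open Logic S
  open AuxNaming N public

  InterpolationProblem : Set₁
  InterpolationProblem = A ∧ᶠ B ⊨ ⊥ᶠ

  open DecMembership _≟ʸ_ using (_∈?_)

  ALocal BLocal : Sym → Set
  ALocal z = z ∈ symb A × z ∉ symb B
  BLocal z = z ∈ symb B × z ∉ symb A

  aLocal? : ∀ z → Dec (ALocal z)
  aLocal? z = (z ∈? symb A) ×-dec ¬? (z ∈? symb B)

  bLocal? : ∀ z → Dec (BLocal z)
  bLocal? z = (z ∈? symb B) ×-dec ¬? (z ∈? symb A)

  hasALocal? : ∀ zs → Dec (Any ALocal zs)
  hasALocal? = any? aLocal?

  hasBLocal? : ∀ zs → Dec (Any BLocal zs)
  hasBLocal? = any? bLocal?

  -- Symbols outside A and B can only be auxiliary variables, which count as shared.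
  locality : List Sym → Locality
  locality zs with hasALocal? zs | hasBLocal? zs
  ... | yes _ | no _  = A-local
  ... | no _  | yes _ = B-local
  ... | no _  | no _  = shared
  ... | yes _ | yes _ = mixed

  -- (a , b) with a the A-local and b the B-local side, if t = u has such sides.
  orient : ∀ {σ} → Term σ → Term σ → Term σ × Term σ
  orient t u with locality (symbᵗ t)
  ... | A-local = t , u
  ... | _       = u , t

  A-part rest : ∀ {ν} → Lin ν → Lin ν
  A-part = filter λ m → hasALocal? (symbᵐ m)
  rest   = filter λ m → ¬? (hasALocal? (symbᵐ m))

  projectEq : ∀ {σ} → Side → (a b : Term σ) → Formula
  projectEq A-side a b = lit (eq a (var (aux (eqKey a b))))
  projectEq B-side a b = lit (eq (var (aux (eqKey a b))) b)

  projectNeq : ∀ {σ} → Side → (a b : Term σ) → Formula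
  projectNeq A-side a b =      lit (pos (var (aux (neqKey a b))))  xorᶠ projectEq A-side a b
  projectNeq B-side a b = (¬ᶠ (lit (pos (var (aux (neqKey a b)))))) xorᶠ projectEq B-side a b

  projectIneq : ∀ {ν} → Side → Ineq ν → Formula
  projectIneq A-side ι@(s ≦ c) =
    lit (ineq (A-part s ++ (1# , var (aux (ineqKey ι))) ∷ [] ≦ 0ᵇ))
  projectIneq B-side ι@(s ≦ c) =
    lit (ineq ((-# 1# , var (aux (ineqKey ι))) ∷ rest s ≦ c))

  -- Mixed Boolean literals have no projection; `Admissible` excludes them.
  projectMixed : Side → Literal → Formula
  projectMixed side (eq t u)  = let (a , b) = orient t u in projectEq side a b
  projectMixed side (neq t u) = let (a , b) = orient t u in projectNeq side a b
  projectMixed side (ineq ι)  = projectIneq side ι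
  projectMixed side (pos _)   = ⊤ᶠ
  projectMixed side (neg _)   = ⊤ᶠ

  sharedOnA : SharedMode → Literal → Formula
  sharedOnA pudlák   ℓ = lit ℓ
  sharedOnA mcMillan ℓ = ⊤ᶠ

  projectAs : Locality → Side → Literal → Formula
  projectAs A-local A-side ℓ = lit ℓ
  projectAs A-local B-side ℓ = ⊤ᶠ
  projectAs B-local A-side ℓ = ⊤ᶠ
  projectAs B-local B-side ℓ = lit ℓ
  projectAs shared  B-side ℓ = lit ℓ
  projectAs shared  A-side ℓ = sharedOnA mode ℓ
  projectAs mixed   side   ℓ = projectMixed side ℓ

  project : Side → Literal → Formula
  project side ℓ = projectAs (locality (symbˡ ℓ)) side ℓ

  negClause : Side → Clause → Formula
  negClause side C = ⋀ᶠ (map (λ ℓ → project side (∼ ℓ)) C)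

  auxOfMixed : Literal → List Sym
  auxOfMixed (eq {σ} t u)  = let (a , b) = orient t u in var σ (aux (eqKey a b)) ∷ []
  auxOfMixed (neq {σ} t u) = let (a , b) = orient t u in
    var σ (aux (eqKey a b)) ∷ var bool (aux (neqKey a b)) ∷ []
  auxOfMixed (ineq {ν} ι)  = var (num ν) (aux (ineqKey ι)) ∷ []
  auxOfMixed (pos _)       = []
  auxOfMixed (neg _)       = []

  auxOf : Literal → List Sym
  auxOf ℓ with locality (symbˡ ℓ)
  ... | mixed = auxOfMixed ℓ
  ... | _     = []

  OppositeSides : ∀ {σ} → Term σ → Term σ → Set
  OppositeSides t u =
    (locality (symbᵗ t) ≡ A-local × locality (symbᵗ u) ≡ B-local) ⊎
    (locality (symbᵗ t) ≡ B-local × locality (symbᵗ u) ≡ A-local)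

  MixedForm : Literal → Set
  MixedForm (eq t u)       = OppositeSides t u
  MixedForm (neq t u)      = OppositeSides t u
  MixedForm (ineq (s ≦ _)) = All (λ m → IsVar (proj₂ m)) s
  MixedForm (pos _)        = ⊥
  MixedForm (neg _)        = ⊥

  Mixed : Literal → Set
  Mixed ℓ = locality (symbˡ ℓ) ≡ mixed

  -- Literals over the symbols of A and B that have projections.
  Admissible : Literal → Set
  Admissible ℓ = (∀ {z} → z ∈ symbˡ ℓ → z ∈ symb A ⊎ z ∈ symb B) × (Mixed ℓ → MixedForm ℓ)

  AuxFree : List Sym → Set
  AuxFree zs = ∀ {σ} (κ : AuxKey σ) → var σ (aux κ) ∉ zs

  NoIneqAux : List Sym → Set
  NoIneqAux zs = ∀ {ν} (ι : Ineq ν) → var (num ν) (aux (ineqKey ι)) ∉ zs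

  -- Every summand is a positive multiple of an auxiliary variable of an
  -- inequality, or does not involve such variables.
  data PatternMonomial {ν} : Monomial ν → Set where
    auxiliary : ∀ {c} (ι : Ineq ν) → Positive c → PatternMonomial (c , var (aux (ineqKey ι)))
    other     : ∀ {c t} → NoIneqAux (symbᵗ t) → PatternMonomial (c , t)

  -- M ∋ ρ ⊒ ρ′: the valuations differ at most in auxiliary variables of
  -- inequalities, which are component-wise at least as large in ρ.
  record _∋_⊒_ (M : Structure) (ρ ρ′ : Valuation M) : Set where
    field
      above : ∀ {ν} (ι : Ineq ν) →
              ρ′ (num ν) (aux (ineqKey ι)) ≤# ρ (num ν) (aux (ineqKey ι))
      same  : ∀ σ x → NoIneqAux (var σ x ∷ []) → ρ σ x ≡ ρ′ σ x

  record IsPattern (π : LA) : Set₁ where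
    open LA π
    field
      linear     : All PatternMonomial s
      covers     : ∀ {ν} (ι : Ineq ν) → let y = var (num ν) (aux (ineqKey ι)) in
                   y ∈ symbᵖ F → y ∈ symbˢ s
      admissible : AdmissibleSlack k
      monotone   : ∀ M (ρ ρ′ : Valuation M) → M ∋ ρ ⊒ ρ′ →
                   holds M ρ (plain F) → holds M ρ′ (plain F)
      bottom     : ∀ M ρ → 0# <# evalˢ M ρ s → ¬ holds M ρ (plain F)
      top        : ∀ M ρ → evalˢ M ρ s <-slack k → holds M ρ (plain F)

  record IsPartialInterpolant (C : Clause) (I : Interpolant) : Set₁ where
    field
      implied      : A ∧ᶠ negClause A-side C ⊨ ⟪ I ⟫
      inconsistent : (B ∧ᶠ negClause B-side C) ∧ᶠ ⟪ I ⟫ ⊨ ⊥ᶠ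
      symbols      : ∀ {z} → z ∈ symbⁱ I →
                     (z ∈ symb A × z ∈ symb B) ⊎ Any (λ ℓ → z ∈ auxOf (∼ ℓ)) C
      patterns     : All IsPattern (leaves I)
      auxInLA      : All (λ ℓ → NoIneqAux (symbˡ ℓ)) (lits I)

{-# OPTIONS --safe #-}

-- F₃ eliminates the pivot's auxiliary variable: F₃ holds iff F₁(v) and F₂(- v)
-- hold for some v. If F₁(v) and F₂(- v), then c₁ v + s₁ ≤ 0 and - c₂ v + s₂ ≤ 0,
-- and by monotonicity v can be moved to one of the finitely many values tested
-- by F₃ (over ℚ with k₁ = 0, this fails only if s₃ < 0). That F₃ is an
-- LA-pattern follows at once. On the A-side, v is the value of the A-local part
-- of the pivot. On the B-side, a model of I₁[I₂[F₃]] yields such a v, and since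
-- either v + b ≤ c or its negation holds, it refutes one of the premises; if
-- I₂[F₃] or F₃ were false, a large value of the auxiliary variable would do the
-- same.

module Submission where

open import Defs
open import Data.Bool using (true; false)
open import Data.Integer as ℤ using (ℤ; +_; ∣_∣; 0ℤ; 1ℤ; -1ℤ)
import Data.Integer.DivMod as ℤ
import Data.Integer.Properties as ℤ
import Data.Integer.Solver as ℤSolver
open import Data.List using (List; []; _∷_; _++_; map; filter; concatMap; upTo)
open import Data.List.Membership.Propositional using (_∈_; _∉_; lose)
open import Data.List.Membership.Propositional.Properties using (∈-upTo⁺; ∈-++⁺ˡ; ∈-++⁺ʳ)
import Data.List.Properties as List
open import Data.List.Relation.Unary.All as All using (All; []; _∷_)
import Data.List.Relation.Unary.All.Properties as All
open import Data.List.Relation.Unary.Any using (Any; here; there)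
import Data.List.Relation.Unary.Any.Properties as Any
open import Data.Maybe using (Maybe; just; nothing; maybe)
import Data.Maybe.Relation.Unary.All as MAll
open import Data.Nat as ℕ using (ℕ; suc)
import Data.Nat.Properties as ℕ
open import Data.Product using (∃; _×_; _,_; proj₁; proj₂)
open import Data.Rational as ℚ using (ℚ; 0ℚ; 1ℚ)
import Data.Rational.Properties as ℚ
import Data.Rational.Solver as ℚSolver
open import Data.Sum as Sum using (_⊎_; inj₁; inj₂; [_,_]′)
open import Data.Unit using (⊤; tt)
open import Function using (_∘_; id; case_of_)
open import Relation.Binary.PropositionalEquality hiding ([_])
open import Relation.Nullary using (¬_; yes; no; contradiction; does; ¬?)
open import Relation.Unary using (Decidable)

-- As a predicate of the pivot's variable alone, a pattern is decreasing and undecided only in a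
-- window: `F₁` is false once `c₁ v + s₁ > 0` and true once `c₁ v + s₁ < -k₁`. Over the integers no
-- point above `q = ⌊-s₁ / c₁⌋` can serve, and at `q - ⌈(k₁ + 1) / c₁⌉` and below `F₁` is true
-- anyway, which gives the range of `i`. The summand `c₁ c₂` of `k₃` is the price of integrality:
-- rounding `(-s₁ - k₁ - 1) / c₁` down costs less than one unit of `v`, that is `c₁ c₂` after the
-- cross-multiplication that eliminates `v`. Over the rationals the most favourable point for `F₂`
-- is `v = -s₁ / c₁`, where the first linear term is exactly 0. There `k₁ = -ε` makes `F₁` true,
-- whereas `k₁ = 0` leaves it open; if it fails there, a smaller point may still serve, but only
-- while `s₃ < 0`. Truth of a formula is a type and is never decided: the semantic case distinctions
-- compare numbers, and the goal on the `B`-side is absurdity, which absorbs double negations.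

-- The semantic content of an LA-pattern, as a property of the pivot's variable alone.
record Cut {ν} (c s : Num ν) (k : Slack ν) (P : Num ν → Set) : Set where
  field
    antitone : ∀ {v w} → v ≤# w → P w → P v
    bounded  : ∀ {v} → P v → ¬ 0# <# c *# v +# s
    total    : ∀ {v} → (c *# v +# s) <-slack k → P v

-- `point` plays the value of the pivot's `A`-local part `a`: the projections `-a + x₁ ≤ 0` and
-- `a + x₂ ≤ 0` bound the two auxiliary variables by `a` and `-a`, hence the opposite arguments.
record Split {ν} (P₁ P₂ : Num ν → Set) : Set where
  constructor split
  field
    {point} : Num ν
    left    : P₁ point
    right   : P₂ (-# point)

-- Elimination of the pivot's variable over the integers.

module Integer where
  open import Data.Integer using (_+_; _*_; -_; _≤_; _<_)
  open ℤSolver.+-*-Solver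

  -- The equation says `r - l = y - x`. Linear arguments thus become one call: `x ≤ y` is a
  -- combination of the hypotheses, and the ring solver checks the equation.
  ≤-shift : ∀ {x y l r} → x ≤ y → l + y ≡ r + x → l ≤ r
  ≤-shift {x} {y} {l} {r} x≤y eq = ℤ.i-j≤0⇒i≤j (subst (_≤ 0ℤ) (begin
    x ℤ.- y             ≡⟨ solve 3 (λ x y r → x :- y := (r :+ x) :- (r :+ y)) refl x y r ⟩
    (r + x) ℤ.- (r + y) ≡⟨ cong (ℤ._- (r + y)) eq ⟨
    (l + y) ℤ.- (r + y) ≡⟨ solve 3 (λ l y r → (l :+ y) :- (r :+ y) := l :- r) refl l y r ⟩
    l ℤ.- r             ∎) (ℤ.i≤j⇒i-j≤0 x≤y))
    where open ≡-Reasoning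

  -- Integer hypotheses and conclusions v < w are used as 1 + v ≤ w.
  <-shift : ∀ {x y l r} → x ≤ y → (1ℤ + l) + y ≡ r + x → l < r
  <-shift x≤y eq = ℤ.suc[i]≤j⇒i<j (≤-shift x≤y eq)

  module _ {c} (c>0 : Positive {int} c) where
    private instance
      _ = c>0
      _ = ∣pos∣-nonZero c c>0
      _ = ℤ.nonNegative (ℤ.<⇒≤ (ℤ.positive⁻¹ c))

    +∣c∣≡c : + ∣ c ∣ ≡ c
    +∣c∣≡c = ℤ.0≤i⇒+∣i∣≡i (ℤ.<⇒≤ (ℤ.positive⁻¹ c))

    floor-lower : ∀ n → c * (n ℤ./ℕ ∣ c ∣) ≤ n
    floor-lower n = subst (_≤ n)
      (trans (cong (n ℤ./ℕ ∣ c ∣ *_) +∣c∣≡c) (ℤ.*-comm (n ℤ./ℕ ∣ c ∣) c))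
      (ℤ.[n/ℕd]*d≤n n ∣ c ∣)

    floor-upper : ∀ n → 1ℤ + n ≤ c * (1ℤ + n ℤ./ℕ ∣ c ∣)
    floor-upper n = ℤ.i<j⇒suc[i]≤j (subst (n <_)
      (trans (cong ((1ℤ + n ℤ./ℕ ∣ c ∣) *_) +∣c∣≡c) (ℤ.*-comm (1ℤ + n ℤ./ℕ ∣ c ∣) c))
      (ℤ.n<s[n/ℕd]*d n ∣ c ∣))

    floor-greatest : ∀ n {v} → c * v ≤ n → v ≤ n ℤ./ℕ ∣ c ∣
    floor-greatest n {v} cv≤n with v ℤ.≤? n ℤ./ℕ ∣ c ∣
    ... | yes v≤q = v≤q
    ... | no  v≰q = contradiction
      (ℤ.≤-trans (floor-upper n)
        (ℤ.≤-trans (ℤ.*-monoˡ-≤-nonNeg c (ℤ.i<j⇒suc[i]≤j (ℤ.≰⇒> v≰q))) cv≤n))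
      (ℤ.<⇒≱ (ℤ.suc[i]≤j⇒i<j ℤ.≤-refl))

    -- The absolute value turns the ceiling into an index in `ℕ`; since `i ≤ ∣ i ∣`, it can only
    -- enlarge the right-hand side.
    ceiling-upper : ∀ n → n ≤ c * (+ ∣ ⌈ n / ∣ c ∣ ⌉ ∣)
    ceiling-upper n = ℤ.≤-trans
      (≤-shift (floor-lower (- n))
        (solve 3 (λ n c q → n :+ (:- n) := (c :* (:- q)) :+ (c :* q)) refl n c _))
      (ℤ.*-monoˡ-≤-nonNeg c (i≤+∣i∣ _))
      where
      i≤+∣i∣ : ∀ i → i ≤ + ∣ i ∣
      i≤+∣i∣ (+ _)       = ℤ.≤-refl
      i≤+∣i∣ ℤ.-[1+ _ ] = ℤ.-≤+

module IntegerSplit {c₁ c₂} (c₁>0 : Positive {int} c₁) (c₂>0 : Positive {int} c₂)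
                    {s₁ s₂ k₁ k₂ P₁ P₂}
                    (cut₁ : Cut {int} c₁ s₁ k₁ P₁) (cut₂ : Cut {int} c₂ s₂ k₂ P₂) where
  open import Data.Integer using (_+_; _*_; -_; _≤_; _<_)
  open ℤSolver.+-*-Solver
  open Integer
  private
    module Cut₁ = Cut cut₁
    module Cut₂ = Cut cut₂
    instance
      _ = c₁>0
      _ = c₂>0
      _ = ∣pos∣-nonZero c₁ c₁>0
      _ = ℤ.nonNegative (ℤ.<⇒≤ (ℤ.positive⁻¹ c₁))
      _ = ℤ.nonNegative (ℤ.<⇒≤ (ℤ.positive⁻¹ c₂))

  q : ℤ
  q = (-1ℤ * s₁) ℤ./ℕ ∣ c₁ ∣

  steps : ℕ
  steps = ∣ ⌈ k₁ + 1ℤ / ∣ c₁ ∣ ⌉ ∣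

  Disjunct : ℕ → Set
  Disjunct i = P₁ (q + -1ℤ * + i) × P₂ (+ i + -1ℤ * q)

  -- `bounded` leaves `c₁ v ≤ -s₁`. This caps the search from above, so that candidates can be
  -- numbered downwards as `q - i`.
  P₁⇒≤q : ∀ {v} → P₁ v → v ≤ q
  P₁⇒≤q {v} p₁ = floor-greatest c₁>0 (-1ℤ * s₁) (≤-shift (ℤ.≮⇒≥ (Cut₁.bounded p₁))
    (solve 3 (λ c v s → c :* v :+ con 0ℤ := con -1ℤ :* s :+ (c :* v :+ s)) refl c₁ v s₁))

  toSplit : ∀ {i} → Disjunct i → Split {int} P₁ P₂
  toSplit {i} (p₁ , p₂) = split p₁
    (subst P₂ (solve 2 (λ i q → i :+ con -1ℤ :* q := :- (q :+ con -1ℤ :* i)) refl (+ i) q) p₂)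

  -- The point `v` has index `q - v`. If that index is too large, `v` is raised to `q - steps`;
  -- raising it lowers the argument of `P₂`, which antitonicity permits.
  fromSplit : Split {int} P₁ P₂ → ∃ λ i → i ℕ.< suc steps × Disjunct i
  fromSplit (split {v} p₁ p₂) with ∣ q ℤ.- v ∣ ℕ.<? suc steps
  ... | yes i≤N = _ , i≤N ,
        Cut₁.antitone (ℤ.≤-reflexive (trans (cong (λ j → q + -1ℤ * j) i≡q-v)
          (solve 2 (λ q v → q :+ con -1ℤ :* (q :- v) := v) refl q v))) p₁ ,
        Cut₂.antitone (ℤ.≤-reflexive (trans (cong (λ j → j + -1ℤ * q) i≡q-v)
          (solve 2 (λ q v → (q :- v) :+ con -1ℤ :* q := :- v) refl q v))) p₂
    where
    i≡q-v : + ∣ q ℤ.- v ∣ ≡ q ℤ.- v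
    i≡q-v = ℤ.0≤i⇒+∣i∣≡i (ℤ.i≤j⇒0≤j-i (P₁⇒≤q p₁))
  -- At the last index the first conjunct is trivially true.
  ... | no  i≰N = steps , ℕ.≤-refl ,
        Cut₁.total (<-shift (ℤ.+-mono-≤ (ceiling-upper c₁>0 (k₁ + 1ℤ)) (floor-lower c₁>0 (-1ℤ * s₁)))
          (solve 5 (λ k c N q s →
              (con 1ℤ :+ (c :* (q :+ con -1ℤ :* N) :+ s)) :+ (c :* N :+ con -1ℤ :* s) :=
              :- k :+ ((k :+ con 1ℤ) :+ c :* q))
            refl k₁ c₁ (+ steps) q s₁)) ,
        Cut₂.antitone (≤-shift N≤q-v
          (solve 3 (λ N q v → (N :+ con -1ℤ :* q) :+ (q :- v) := :- v :+ N) refl (+ steps) q v)) p₂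
    where
    N≤q-v : + steps ≤ q ℤ.- v
    N≤q-v = subst (+ steps ≤_) (ℤ.0≤i⇒+∣i∣≡i (ℤ.i≤j⇒0≤j-i (P₁⇒≤q p₁)))
      (ℤ.+≤+ (ℕ.≤-trans (ℕ.n≤1+n _) (ℕ.≮⇒≥ i≰N)))

  -- The witness is the largest v at which P₁ is trivially true.
  split-total : (c₂ * s₁ + c₁ * s₂) < - (c₂ * k₁ + c₁ * k₂ + c₁ * c₂) → Split {int} P₁ P₂
  split-total s₃<-k₃ = split {point = v}
    (Cut₁.total (<-shift (floor-lower c₁>0 n)
      (solve 4 (λ c v s k →
          (con 1ℤ :+ (c :* v :+ s)) :+ (:- s :- k :- con 1ℤ) := :- k :+ c :* v)
        refl c₁ v s₁ k₁)))
    (Cut₂.total (ℤ.*-cancelˡ-<-nonNeg c₁ (<-shift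
      (ℤ.+-mono-≤ (ℤ.i<j⇒suc[i]≤j s₃<-k₃) (ℤ.*-monoˡ-≤-nonNeg c₂ (floor-upper c₁>0 n)))
      (solve 7 (λ c d s t k l v →
          (con 1ℤ :+ c :* (d :* (:- v) :+ t)) :+
            (:- (d :* k :+ c :* l :+ c :* d) :+ d :* (c :* (con 1ℤ :+ v))) :=
          c :* (:- l) :+
            ((con 1ℤ :+ (d :* s :+ c :* t)) :+ d :* (con 1ℤ :+ (:- s :- k :- con 1ℤ))))
        refl c₁ c₂ s₁ s₂ k₁ k₂ v))))
    where
    n v : ℤ
    n = - s₁ ℤ.- k₁ ℤ.- 1ℤ
    v = n ℤ./ℕ ∣ c₁ ∣

  -- Adding `c₂` times the first bound to `c₁` times the second cancels the point.
  split-bounded : Split {int} P₁ P₂ → ¬ 0ℤ < c₂ * s₁ + c₁ * s₂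
  split-bounded (split {v} p₁ p₂) = ℤ.≤⇒≯ (≤-shift
    (ℤ.+-mono-≤ (ℤ.*-monoˡ-≤-nonNeg c₂ (ℤ.≮⇒≥ (Cut₁.bounded p₁)))
                (ℤ.*-monoˡ-≤-nonNeg c₁ (ℤ.≮⇒≥ (Cut₂.bounded p₂))))
    (solve 5 (λ c d s t v →
        (d :* s :+ c :* t) :+ (d :* con 0ℤ :+ c :* con 0ℤ) :=
        con 0ℤ :+ (d :* (c :* v :+ s) :+ c :* (d :* (:- v) :+ t)))
      refl c₁ c₂ s₁ s₂ v))

-- Elimination of the pivot's variable over the rationals.

module Real where
  open import Data.Rational using (_+_; _*_; -_; _≤_; _<_)
  open ℚSolver.+-*-Solver

  ≤-shift : ∀ {x y l r} → x ≤ y → l + y ≡ r + x → l ≤ r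
  ≤-shift {x} {y} {l} {r} x≤y eq = subst₂ _≤_
    (trans (cong (ℚ._- y) (sym eq)) (solve 2 (λ l y → (l :+ y) :- y := l) refl l y))
    (solve 2 (λ r y → (r :+ y) :- y := r) refl r y)
    (ℚ.+-monoˡ-≤ (- y) (ℚ.+-monoʳ-≤ r x≤y))

  <-shift : ∀ {x y l r} → x < y → l + y ≡ r + x → l < r
  <-shift {x} {y} {l} {r} x<y eq = subst₂ _<_
    (trans (cong (ℚ._- y) (sym eq)) (solve 2 (λ l y → (l :+ y) :- y := l) refl l y))
    (solve 2 (λ r y → (r :+ y) :- y := r) refl r y)
    (ℚ.+-monoˡ-< (- y) (ℚ.+-monoʳ-< r x<y))

  <⇒<-slack : ∀ k {v} → v < 0ℚ → _<-slack_ {real} v k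
  <⇒<-slack k=0  v<0 = v<0
  <⇒<-slack k=-ε v<0 = ℚ.<⇒≤ v<0

module RealSplit {c₁ c₂} (c₁>0 : Positive {real} c₁) (c₂>0 : Positive {real} c₂)
                 {s₁ s₂ k₁ k₂ P₁ P₂}
                 (cut₁ : Cut {real} c₁ s₁ k₁ P₁) (cut₂ : Cut {real} c₂ s₂ k₂ P₂) where
  open import Data.Rational using (_+_; _*_; -_; _≤_; _<_)
  open ℚSolver.+-*-Solver
  open Real
  private
    module Cut₁ = Cut cut₁
    module Cut₂ = Cut cut₂
    instance
      _ = c₁>0
      _ = c₂>0
      _ = ℚ.pos⇒nonZero c₁
      _ = ℚ.pos⇒nonZero c₂
      _ = ℚ.pos⇒nonNeg c₁
      _ = ℚ.pos⇒nonNeg c₂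

    r₁ r₂ : ℚ
    r₁ = ℚ.1/ c₁
    r₂ = ℚ.1/ c₂

    instance
      _ : ℚ.Positive r₁
      _ = ℚ.1/pos⇒pos c₁
      _ : ℚ.NonNegative r₁
      _ = ℚ.pos⇒nonNeg r₁

    c₁r₁ : ∀ x → c₁ * (r₁ * x) ≡ x
    c₁r₁ x = trans (sym (ℚ.*-assoc c₁ r₁ x))
      (trans (cong (_* x) (ℚ.*-inverseʳ c₁)) (ℚ.*-identityˡ x))

    c₂r₂ : ∀ x → c₂ * (r₂ * x) ≡ x
    c₂r₂ x = trans (sym (ℚ.*-assoc c₂ r₂ x))
      (trans (cong (_* x) (ℚ.*-inverseʳ c₂)) (ℚ.*-identityˡ x))

  q s₃ : ℚ
  q = r₁ * s₁
  s₃ = c₂ * s₁ + c₁ * s₂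

  private
    c₁[-q]+s₁ : c₁ * (- q) + s₁ ≡ 0ℚ
    c₁[-q]+s₁ = trans (solve 3 (λ c q s → c :* (:- q) :+ s := :- (c :* q) :+ s) refl c₁ q s₁)
      (trans (cong (λ x → - x + s₁) (c₁r₁ s₁)) (ℚ.+-inverseˡ s₁))

    c₁[c₂q+s₂] : c₁ * (c₂ * q + s₂) ≡ s₃
    c₁[c₂q+s₂] = trans
      (solve 4 (λ c d q t → c :* (d :* q :+ t) := d :* (c :* q) :+ c :* t) refl c₁ c₂ q s₂)
      (cong (λ x → c₂ * x + c₁ * s₂) (c₁r₁ s₁))

    q≤-v : ∀ {v} → P₁ v → q ≤ - v
    q≤-v {v} p₁ = ℚ.*-cancelˡ-≤-pos c₁ (≤-shift (ℚ.≮⇒≥ (Cut₁.bounded p₁))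
      (trans (ℚ.+-identityʳ _) (trans (c₁r₁ s₁)
        (solve 3 (λ c v s → s := c :* (:- v) :+ (c :* v :+ s)) refl c₁ v s₁))))

  split-bounded : Split {real} P₁ P₂ → ¬ 0ℚ < s₃
  split-bounded (split {v} p₁ p₂) 0<s₃ = ℚ.<-irrefl refl (ℚ.<-≤-trans 0<s₃ (≤-shift
    (ℚ.+-mono-≤ (ℚ.*-monoˡ-≤-nonNeg c₂ (ℚ.≮⇒≥ (Cut₁.bounded p₁)))
                (ℚ.*-monoˡ-≤-nonNeg c₁ (ℚ.≮⇒≥ (Cut₂.bounded p₂))))
    (solve 5 (λ c d s t v →
        (d :* s :+ c :* t) :+ (d :* con 0ℚ :+ c :* con 0ℚ) :=
        con 0ℚ :+ (d :* (c :* v :+ s) :+ c :* (d :* (:- v) :+ t)))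
      refl c₁ c₂ s₁ s₂ v)))

  -- Both conjuncts are trivially true strictly between s₂ / c₂ and - s₁ / c₁.
  split-dense : s₃ < 0ℚ → Split {real} P₁ P₂
  split-dense s₃<0 = split {point = v}
    (Cut₁.total (<⇒<-slack k₁ below)) (Cut₂.total (<⇒<-slack k₂ above))
    where
    r₂s₂<-q : r₂ * s₂ < - q
    r₂s₂<-q = ℚ.*-cancelˡ-<-nonNeg c₁ (ℚ.*-cancelˡ-<-nonNeg c₂ (<-shift s₃<0 (begin
      c₂ * (c₁ * (r₂ * s₂)) + 0ℚ
        ≡⟨ solve 3 (λ c d x → d :* (c :* x) :+ con 0ℚ := c :* (d :* x)) refl c₁ c₂ (r₂ * s₂) ⟩
      c₁ * (c₂ * (r₂ * s₂))
        ≡⟨ cong (c₁ *_) (c₂r₂ s₂) ⟩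
      c₁ * s₂
        ≡⟨ solve 4 (λ c d s t → c :* t := d :* (:- s) :+ (d :* s :+ c :* t)) refl c₁ c₂ s₁ s₂ ⟩
      c₂ * (- s₁) + s₃
        ≡⟨ cong (λ x → c₂ * (- x) + s₃) (c₁r₁ s₁) ⟨
      c₂ * (- (c₁ * q)) + s₃
        ≡⟨ cong (λ x → c₂ * x + s₃) (ℚ.neg-distribʳ-* c₁ q) ⟩
      c₂ * (c₁ * (- q)) + s₃ ∎)))
      where open ≡-Reasoning
    between : ∃ λ v → r₂ * s₂ < v × v < - q
    between = ℚ.<-dense r₂s₂<-q
    v : ℚ
    v = proj₁ between
    below : c₁ * v + s₁ < 0ℚ
    below = subst (c₁ * v + s₁ <_) c₁[-q]+s₁
      (ℚ.+-monoˡ-< s₁ (ℚ.*-monoʳ-<-pos c₁ (proj₂ (proj₂ between))))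
    above : c₂ * (- v) + s₂ < 0ℚ
    above = <-shift (ℚ.*-monoʳ-<-pos c₂ (proj₁ (proj₂ between))) (begin
      c₂ * (- v) + s₂ + c₂ * v
        ≡⟨ solve 3 (λ d t v → (d :* (:- v) :+ t) :+ d :* v := con 0ℚ :+ t) refl c₂ s₂ v ⟩
      0ℚ + s₂
        ≡⟨ cong (λ x → 0ℚ + x) (c₂r₂ s₂) ⟨
      0ℚ + c₂ * (r₂ * s₂) ∎)
      where open ≡-Reasoning

  -- At `-q` the first linear term vanishes, so a slack that tolerates 0, namely `-ε`, settles `P₁`
  -- by `total`.
  split-at-q : _<-slack_ {real} 0ℚ k₁ → P₂ q → Split {real} P₁ P₂
  split-at-q 0<-k₁ p₂ = split {point = - q}
    (Cut₁.total (subst (λ x → _<-slack_ {real} x k₁) (sym c₁[-q]+s₁) 0<-k₁))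
    (subst P₂ (solve 1 (λ q → q := :- (:- q)) refl q) p₂)

  -- At `q` the second linear term is `s₃ / c₁` and has the sign of `s₃`; this is why `k₂` can be
  -- inherited unchanged.
  split-at-q-total : _<-slack_ {real} s₃ k₂ → P₂ q
  split-at-q-total = Cut₂.total ∘ scale k₂
    where
    scale : ∀ k → _<-slack_ {real} s₃ k → _<-slack_ {real} (c₂ * q + s₂) k
    scale k=0  s₃<0 = ℚ.*-cancelˡ-<-nonNeg c₁
      (subst₂ _<_ (sym c₁[c₂q+s₂]) (sym (ℚ.*-zeroʳ c₁)) s₃<0)
    scale k=-ε s₃≤0 = ℚ.*-cancelˡ-≤-pos c₁
      (subst₂ _≤_ (sym c₁[c₂q+s₂]) (sym (ℚ.*-zeroʳ c₁)) s₃≤0)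

  toSplit : P₁ ((ℚ.- 1ℚ) * q) × P₂ q → Split {real} P₁ P₂
  toSplit (p₁ , p₂) = split p₁ (subst P₂ (solve 1 (λ q → q := :- (con (ℚ.- 1ℚ) :* q)) refl q) p₂)

  -- `P₁` admits no point above `-q`, so `q` is the least argument that `P₂` can be given, and the
  -- easiest to satisfy.
  P₂-at-q : Split {real} P₁ P₂ → P₂ q
  P₂-at-q (split p₁ p₂) = Cut₂.antitone (q≤-v p₁) p₂

  -- If `s₃ ≥ 0`, the point is forced to be the tested one: `c₂ (c₁ v + s₁) = s₃ - c₁ (s₂ - c₂ v)`
  -- is nonnegative, which gives `-q ≤ v`, and `P₁` gives the converse.
  fromSplit : Split {real} P₁ P₂ → s₃ < 0ℚ ⊎ P₁ ((ℚ.- 1ℚ) * q) × P₂ q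
  fromSplit sp@(split {v} p₁ p₂) with s₃ ℚ.<? 0ℚ
  ... | yes s₃<0 = inj₁ s₃<0
  ... | no  s₃≮0 = inj₂ (Cut₁.antitone -q≤v p₁ , P₂-at-q sp)
    where
    0≤c₁v+s₁ : 0ℚ ≤ c₁ * v + s₁
    0≤c₁v+s₁ = ℚ.*-cancelˡ-≤-pos c₂ (≤-shift
      (ℚ.+-mono-≤ (ℚ.≮⇒≥ s₃≮0) (ℚ.*-monoˡ-≤-nonNeg c₁ (ℚ.≮⇒≥ (Cut₂.bounded p₂))))
      (solve 5 (λ c d s t v →
          d :* con 0ℚ :+ ((d :* s :+ c :* t) :+ c :* con 0ℚ) :=
          d :* (c :* v :+ s) :+ (con 0ℚ :+ c :* (d :* (:- v) :+ t)))
        refl c₁ c₂ s₁ s₂ v))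
    -q≤v : (ℚ.- 1ℚ) * q ≤ v
    -q≤v = ℚ.*-cancelˡ-≤-pos c₁ (≤-shift 0≤c₁v+s₁
      (trans (solve 4 (λ c q v s →
          c :* (con (ℚ.- 1ℚ) :* q) :+ (c :* v :+ s) := c :* v :+ (c :* (:- q) :+ s))
          refl c₁ q v s₁)
        (cong (λ x → c₁ * v + x) c₁[-q]+s₁)))

-- Arithmetic and bounds uniform in the number sort.

+#-identityˡ : ∀ {ν} (a : Num ν) → 0# +# a ≡ a
+#-identityˡ {int}  = ℤ.+-identityˡ
+#-identityˡ {real} = ℚ.+-identityˡ

+#-assoc : ∀ {ν} (a b c : Num ν) → (a +# b) +# c ≡ a +# (b +# c)
+#-assoc {int}  = ℤ.+-assoc
+#-assoc {real} = ℚ.+-assoc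

*#-assoc : ∀ {ν} (a b c : Num ν) → (a *# b) *# c ≡ a *# (b *# c)
*#-assoc {int}  = ℤ.*-assoc
*#-assoc {real} = ℚ.*-assoc

*#-distribˡ-+# : ∀ {ν} (a b c : Num ν) → a *# (b +# c) ≡ a *# b +# a *# c
*#-distribˡ-+# {int}  = ℤ.*-distribˡ-+
*#-distribˡ-+# {real} = ℚ.*-distribˡ-+

*#-zeroʳ : ∀ {ν} (a : Num ν) → a *# 0# ≡ 0#
*#-zeroʳ {int}  = ℤ.*-zeroʳ
*#-zeroʳ {real} = ℚ.*-zeroʳ

-1*-involutive : ∀ {ν} (a : Num ν) → (-# 1#) *# ((-# 1#) *# a) ≡ a
-1*-involutive {int}  = solve 1 (λ a → con -1ℤ :* (con -1ℤ :* a) := a) refl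
  where open ℤSolver.+-*-Solver
-1*-involutive {real} = solve 1 (λ a → con (ℚ.- 1ℚ) :* (con (ℚ.- 1ℚ) :* a) := a) refl
  where open ℚSolver.+-*-Solver

-1*≡- : ∀ {ν} (a : Num ν) → (-# 1#) *# a ≡ -# a
-1*≡- {int}  = ℤ.-1*i≡-i
-1*≡- {real} = solve 1 (λ a → con (ℚ.- 1ℚ) :* a := :- a) refl
  where open ℚSolver.+-*-Solver

pos*pos : ∀ {ν} (a b : Num ν) → Positive a → Positive b → Positive (a *# b)
pos*pos {int}  (+ suc _) (+ suc _) _   _   = _
pos*pos {real} a         b         a>0 b>0 = ℚ.pos*pos⇒pos a {{a>0}} b {{b>0}}

≤#-refl : ∀ {ν} {a : Num ν} → a ≤# a
≤#-refl {int}  = ℤ.≤-refl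
≤#-refl {real} = ℚ.≤-refl

complement-involutive : ∀ {ν} (c : Bound ν) → complement (complement c) ≡ c
complement-involutive {int} = solve 1 (λ c → :- (:- c :- con 1ℤ) :- con 1ℤ := c) refl
  where open ℤSolver.+-*-Solver
complement-involutive {real} (std q)    = cong std (solve 1 (λ q → :- (:- q) := q) refl q)
  where open ℚSolver.+-*-Solver
complement-involutive {real} (q minusε) = cong _minusε (solve 1 (λ q → :- (:- q) := q) refl q)
  where open ℚSolver.+-*-Solver

-- Written in the shape to which the `A`-projection of a mixed inequality evaluates when its
-- auxiliary variable is `-a`.
a-a≤ᵇ0 : ∀ {ν} (a : Num ν) → a +# (1# *# (-# a) +# 0#) ≤ᵇ 0ᵇ
a-a≤ᵇ0 {int} a = ℤ.≤-reflexive (solve 1 (λ a → a :+ (con 1ℤ :* (:- a) :+ con 0ℤ) := con 0ℤ) refl a)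
  where open ℤSolver.+-*-Solver
a-a≤ᵇ0 {real} a = ℚ.≤-reflexive (solve 1 (λ a → a :+ (con 1ℚ :* (:- a) :+ con 0ℚ) := con 0ℚ) refl a)
  where open ℚSolver.+-*-Solver

-- The auxiliary variable has coefficient `-1` in a `B`-projection, so choosing it large satisfies
-- that projection whatever the other variables are.
≤ᵇ-unbounded : ∀ {ν} (b : Num ν) (c : Bound ν) → ∃ λ v → (-# 1#) *# v +# b ≤ᵇ c
≤ᵇ-unbounded {int} b c = b ℤ.- c ,
  ℤ.≤-reflexive (solve 2 (λ b c → con -1ℤ :* (b :- c) :+ b := c) refl b c)
  where open ℤSolver.+-*-Solver
≤ᵇ-unbounded {real} b (std q) = b ℚ.- q ,
  ℚ.≤-reflexive (solve 2 (λ b q → con (ℚ.- 1ℚ) :* (b :- q) :+ b := q) refl b q)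
  where open ℚSolver.+-*-Solver
-- The value `b - q` would give equality; the extra 1 makes the inequality strict.
≤ᵇ-unbounded {real} b (q minusε) = b ℚ.- q ℚ.+ 1ℚ ,
  Real.<-shift (ℚ.positive⁻¹ 1ℚ)
    (solve 2 (λ b q → (con (ℚ.- 1ℚ) :* (b :- q :+ con 1ℚ) :+ b) :+ con 1ℚ := q :+ con 0ℚ) refl b q)
  where open ℚSolver.+-*-Solver

-- The alternatives are `v + b ≤ c` and its negation, in the form of the `B`-projections of the
-- pivot at `x₂ = -v` and of the negated pivot at `x₁ = v`.
≤ᵇ-dichotomy : ∀ {ν} (v b : Num ν) (c : Bound ν) →
               (-# 1#) *# (-# v) +# b ≤ᵇ c ⊎
               (-# 1#) *# v +# (-# 1#) *# b ≤ᵇ complement c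
≤ᵇ-dichotomy {int} v b c with (ℤ.- 1ℤ) ℤ.* (ℤ.- v) ℤ.+ b ℤ.≤? c
... | yes ≤c = inj₁ ≤c
... | no  ≰c = inj₂ (Integer.≤-shift (ℤ.i<j⇒suc[i]≤j (ℤ.≰⇒> ≰c))
  (solve 3 (λ v b c →
      (con -1ℤ :* v :+ con -1ℤ :* b) :+ (con -1ℤ :* (:- v) :+ b) :=
      (:- c :- con 1ℤ) :+ (con 1ℤ :+ c))
    refl v b c))
  where open ℤSolver.+-*-Solver
≤ᵇ-dichotomy {real} v b (std q) with (ℚ.- 1ℚ) ℚ.* (ℚ.- v) ℚ.+ b ℚ.≤? q
... | yes ≤q = inj₁ ≤q
... | no  ≰q = inj₂ (Real.<-shift (ℚ.≰⇒> ≰q)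
  (solve 3 (λ v b q →
      (con (ℚ.- 1ℚ) :* v :+ con (ℚ.- 1ℚ) :* b) :+ (con (ℚ.- 1ℚ) :* (:- v) :+ b) := :- q :+ q)
    refl v b q))
  where open ℚSolver.+-*-Solver
≤ᵇ-dichotomy {real} v b (q minusε) with (ℚ.- 1ℚ) ℚ.* (ℚ.- v) ℚ.+ b ℚ.<? q
... | yes <q = inj₁ <q
... | no  ≮q = inj₂ (Real.≤-shift (ℚ.≮⇒≥ ≮q)
  (solve 3 (λ v b q →
      (con (ℚ.- 1ℚ) :* v :+ con (ℚ.- 1ℚ) :* b) :+ (con (ℚ.- 1ℚ) :* (:- v) :+ b) := :- q :+ q)
    refl v b q))
  where open ℚSolver.+-*-Solver

split-bounded : ∀ {ν} {c₁ c₂ : Num ν} → Positive c₁ → Positive c₂ → ∀ {s₁ s₂ k₁ k₂ P₁ P₂} →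
                Cut c₁ s₁ k₁ P₁ → Cut c₂ s₂ k₂ P₂ → Split {ν} P₁ P₂ → ¬ 0# <# c₂ *# s₁ +# c₁ *# s₂
split-bounded {int}  = IntegerSplit.split-bounded
split-bounded {real} = RealSplit.split-bounded

-- Literals and leaves of filled contexts.

module _ {L P : Set} where

  fill-lits⁺ : ∀ {R : L → Set} (φ : NNF L (Maybe P)) {χ} →
               All R (lits φ) → All R (lits χ) → All R (lits (φ [ χ ]))
  fill-lits⁺ (lit _)  rs rχ = rs
  fill-lits⁺ ⊤ⁿ       rs rχ = rs
  fill-lits⁺ ⊥ⁿ       rs rχ = rs
  fill-lits⁺ (φ ∧ⁿ ψ) rs rχ = let (l , r) = All.++⁻ (lits φ) rs in
    All.++⁺ (fill-lits⁺ φ l rχ) (fill-lits⁺ ψ r rχ)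
  fill-lits⁺ (φ ∨ⁿ ψ) rs rχ = let (l , r) = All.++⁻ (lits φ) rs in
    All.++⁺ (fill-lits⁺ φ l rχ) (fill-lits⁺ ψ r rχ)
  fill-lits⁺ (leaf (just _)) rs rχ = rs
  fill-lits⁺ (leaf nothing)  rs rχ = rχ

  fill-lits⁻ : ∀ {R : L → Set} (φ : NNF L (Maybe P)) {χ} →
               All R (lits (φ [ χ ])) → All R (lits φ)
  fill-lits⁻ (lit _)  rs = rs
  fill-lits⁻ ⊤ⁿ       rs = rs
  fill-lits⁻ ⊥ⁿ       rs = rs
  fill-lits⁻ (φ ∧ⁿ ψ) {χ} rs = let (l , r) = All.++⁻ (lits (φ [ χ ])) rs in
    All.++⁺ (fill-lits⁻ φ l) (fill-lits⁻ ψ r)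
  fill-lits⁻ (φ ∨ⁿ ψ) {χ} rs = let (l , r) = All.++⁻ (lits (φ [ χ ])) rs in
    All.++⁺ (fill-lits⁻ φ l) (fill-lits⁻ ψ r)
  fill-lits⁻ (leaf _) rs = []

  -- `MAll.All Q` is vacuous at the holes, so their content is accounted for by the separate
  -- hypothesis on `χ`.
  fill-leaves⁺ : ∀ {a} {Q : P → Set a} (φ : NNF L (Maybe P)) {χ} →
                 All (MAll.All Q) (leaves φ) → All Q (leaves χ) → All Q (leaves (φ [ χ ]))
  fill-leaves⁺ (lit _)  qs qχ = []
  fill-leaves⁺ ⊤ⁿ       qs qχ = []
  fill-leaves⁺ ⊥ⁿ       qs qχ = []
  fill-leaves⁺ (φ ∧ⁿ ψ) qs qχ = let (l , r) = All.++⁻ (leaves φ) qs in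
    All.++⁺ (fill-leaves⁺ φ l qχ) (fill-leaves⁺ ψ r qχ)
  fill-leaves⁺ (φ ∨ⁿ ψ) qs qχ = let (l , r) = All.++⁻ (leaves φ) qs in
    All.++⁺ (fill-leaves⁺ φ l qχ) (fill-leaves⁺ ψ r qχ)
  fill-leaves⁺ (leaf (just _)) (MAll.just q ∷ []) qχ = q ∷ []
  fill-leaves⁺ (leaf nothing)  qs                 qχ = qχ

  fill-leaves⁻ : ∀ {a} {Q : P → Set a} (φ : NNF L (Maybe P)) {χ} →
                 All Q (leaves (φ [ χ ])) → All (MAll.All Q) (leaves φ)
  fill-leaves⁻ (lit _)  qs = []
  fill-leaves⁻ ⊤ⁿ       qs = []
  fill-leaves⁻ ⊥ⁿ       qs = []
  fill-leaves⁻ (φ ∧ⁿ ψ) {χ} qs = let (l , r) = All.++⁻ (leaves (φ [ χ ])) qs in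
    All.++⁺ (fill-leaves⁻ φ l) (fill-leaves⁻ ψ r)
  fill-leaves⁻ (φ ∨ⁿ ψ) {χ} qs = let (l , r) = All.++⁻ (leaves (φ [ χ ])) qs in
    All.++⁺ (fill-leaves⁻ φ l) (fill-leaves⁻ ψ r)
  fill-leaves⁻ (leaf (just _)) (q ∷ []) = MAll.just q ∷ []
  fill-leaves⁻ (leaf nothing)  qs       = MAll.nothing ∷ []

  -- A context without holes would discard `χ`; `HasHole` is what lets a premise vouch for its
  -- displayed pattern.
  hole-leaves : ∀ {a} {Q : P → Set a} (φ : NNF L (Maybe P)) {χ} → HasHole φ →
                All Q (leaves (φ [ χ ])) → All Q (leaves χ)
  hole-leaves (φ ∧ⁿ ψ) {χ} hole qs with Any.++⁻ (leaves φ) hole | All.++⁻ (leaves (φ [ χ ])) qs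
  ... | inj₁ inφ | l , _ = hole-leaves φ inφ l
  ... | inj₂ inψ | _ , r = hole-leaves ψ inψ r
  hole-leaves (φ ∨ⁿ ψ) {χ} hole qs with Any.++⁻ (leaves φ) hole | All.++⁻ (leaves (φ [ χ ])) qs
  ... | inj₁ inφ | l , _ = hole-leaves φ inφ l
  ... | inj₂ inψ | _ , r = hole-leaves ψ inψ r
  hole-leaves (leaf nothing) hole qs = qs
  hole-leaves (leaf (just _)) (here ())
  hole-leaves (leaf (just _)) (there ())

-- Symbols of contexts, linear terms, substitutions and `F₃`.

module Semantics (S : Signature) where

  open Logic S

  -- Here the rational `k₃` finds its justification. For `k₁ = -ε` the point `-q` is free of charge
  -- for the first cut and `k₂` survives; for `k₁ = 0` a point strictly inside the gap is used, and
  -- there is one exactly when `s₃ < 0`.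
  split-total : ∀ {ν} {c₁ c₂ : Num ν} → Positive c₁ → Positive c₂ → ∀ {s₁ s₂ k₁ k₂ P₁ P₂} →
                Cut c₁ s₁ k₁ P₁ → Cut c₂ s₂ k₂ P₂ →
                (c₂ *# s₁ +# c₁ *# s₂) <-slack k₃ {ν} c₁ c₂ k₁ k₂ → Split {ν} P₁ P₂
  split-total {int}  = IntegerSplit.split-total
  split-total {real} c₁>0 c₂>0 {k₁ = k=-ε} cut₁ cut₂ s₃<-k₂ =
    split-at-q ℚ.≤-refl (split-at-q-total s₃<-k₂)
    where open RealSplit c₁>0 c₂>0 cut₁ cut₂
  split-total {real} c₁>0 c₂>0 {k₁ = k=0}  cut₁ cut₂ s₃<0 =
    RealSplit.split-dense c₁>0 c₂>0 cut₁ cut₂ s₃<0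

  -- Over the integers k₃ + 1 = c₂ (k₁ + 1) + c₁ (k₂ + 1) + (c₁ - 1) (c₂ - 1).
  slack-admissible : ∀ {ν} {c₁ c₂ : Num ν} → Positive c₁ → Positive c₂ → ∀ {k₁ k₂ : Slack ν} →
                     AdmissibleSlack k₁ → AdmissibleSlack k₂ → AdmissibleSlack (k₃ {ν} c₁ c₂ k₁ k₂)
  slack-admissible {real} _ _ _ _ = _
  slack-admissible {int} {c₁} {c₂} c₁>0 c₂>0 {k₁} {k₂} k₁≥-1 k₂≥-1 = Integer.≤-shift
    (ℤ.+-mono-≤ (ℤ.+-mono-≤ (ℤ.*-monoˡ-≤-nonNeg c₂ k₁≥-1) (ℤ.*-monoˡ-≤-nonNeg c₁ k₂≥-1))
                (ℤ.*-monoˡ-≤-nonNeg (c₁ ℤ.- 1ℤ) (1≤ c₂>0)))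
    (solve 4 (λ c d k l →
        con -1ℤ :+ (d :* k :+ c :* l :+ (c :- con 1ℤ) :* d) :=
        (d :* k :+ c :* l :+ c :* d) :+
          (d :* con -1ℤ :+ c :* con -1ℤ :+ (c :- con 1ℤ) :* con 1ℤ))
      refl c₁ c₂ k₁ k₂)
    where
    open ℤSolver.+-*-Solver
    1≤ : ∀ {c} → Positive {int} c → 1ℤ ℤ.≤ c
    1≤ {c} c>0 = ℤ.i<j⇒suc[i]≤j (ℤ.positive⁻¹ c {{c>0}})
    instance
      _ = ℤ.nonNegative (ℤ.≤-trans (ℤ.+≤+ ℕ.z≤n) (1≤ c₁>0))
      _ = ℤ.nonNegative (ℤ.≤-trans (ℤ.+≤+ ℕ.z≤n) (1≤ c₂>0))
      _ = ℤ.nonNegative (ℤ.i≤j⇒0≤j-i (1≤ c₁>0))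

  var-injective : ∀ {σ τ x y} → Sym.var σ x ≡ var τ y → σ ≡ τ × x ≡ y
  var-injective refl = refl , refl

  concatMap⁺ : ∀ {X : Set} {R : Sym → Set} {f : X → List Sym} {xs} →
               All (All R ∘ f) xs → All R (concatMap f xs)
  concatMap⁺ = All.concat⁺ ∘ All.map⁺

  concatMap⁻ : ∀ {X : Set} {R : Sym → Set} {f : X → List Sym} {xs} →
               All R (concatMap f xs) → All (All R ∘ f) xs
  concatMap⁻ = All.map⁻ ∘ All.concat⁻

  symbⁿ⁻ : ∀ {P} {R : Sym → Set} {f : P → List Sym} (φ : NNF Literal P) → All R (symbⁿ f φ) →
           All (All R ∘ symbˡ) (lits φ) × All (All R ∘ f) (leaves φ)
  symbⁿ⁻ φ rs = let (l , r) = All.++⁻ (concatMap symbˡ (lits φ)) rs in concatMap⁻ l , concatMap⁻ r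

  symbⁿ⁺ : ∀ {P} {R : Sym → Set} {f : P → List Sym} (φ : NNF Literal P) →
           All (All R ∘ symbˡ) (lits φ) → All (All R ∘ f) (leaves φ) → All R (symbⁿ f φ)
  symbⁿ⁺ φ l r = All.++⁺ (concatMap⁺ l) (concatMap⁺ r)

  symbᵖ⁺ : ∀ {R : Sym → Set} (F : Plain) → All (All R ∘ symbˡ) (lits F) → All R (symbᵖ F)
  symbᵖ⁺ F l = symbⁿ⁺ F l (All.universal (λ ()) (leaves F))

  symbᵖ⁻ : ∀ {R : Sym → Set} (F : Plain) → All R (symbᵖ F) → All (All R ∘ symbˡ) (lits F)
  symbᵖ⁻ F rs = proj₁ (symbⁿ⁻ F rs)

  fill-symbⁱ⁺ : ∀ {R : Sym → Set} (I : Context) {χ} →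
                All R (symbᶜ I) → All R (symbⁱ χ) → All R (symbⁱ (I [ χ ]))
  fill-symbⁱ⁺ {R} I {χ} rI rχ with symbⁿ⁻ I rI | symbⁿ⁻ χ rχ
  ... | lI , pI | lχ , pχ = symbⁿ⁺ (I [ χ ]) (fill-lits⁺ I lI lχ)
    (fill-leaves⁺ I (All.map (λ { {just _} r → MAll.just r ; {nothing} _ → MAll.nothing }) pI) pχ)

  fill-symbⁱ⁻ : ∀ {R : Sym → Set} (I : Context) {χ} → All R (symbⁱ (I [ χ ])) → All R (symbᶜ I)
  fill-symbⁱ⁻ I {χ} rs with symbⁿ⁻ (I [ χ ]) rs
  ... | l , p = symbⁿ⁺ I (fill-lits⁻ I l)
    (All.map (λ { (MAll.just r) → r ; MAll.nothing → [] }) (fill-leaves⁻ I p))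

  hole-symbᴸᴬ : ∀ {R : Sym → Set} (I : Context) {π} → HasHole I →
                All R (symbⁱ (I [ leaf π ])) → All R (symbᴸᴬ π)
  hole-symbᴸᴬ I {π} hole rs with hole-leaves I hole (proj₂ (symbⁿ⁻ (I [ leaf π ]) rs))
  ... | r ∷ [] = r

  symbˢ-· : ∀ {ν} (c : Num ν) (s : Lin ν) → symbˢ (c · s) ≡ symbˢ s
  symbˢ-· c []      = refl
  symbˢ-· c (m ∷ s) = cong (symbᵐ m ++_) (symbˢ-· c s)

  symbˢ-s₃ : ∀ {ν} (c₁ c₂ : Num ν) s₁ s₂ → symbˢ (s₃ c₁ c₂ s₁ s₂) ≡ symbˢ s₁ ++ symbˢ s₂
  symbˢ-s₃ c₁ c₂ s₁ s₂ = trans (List.concatMap-++ symbᵐ (c₂ · s₁) (c₁ · s₂))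
    (cong₂ _++_ (symbˢ-· c₂ s₁) (symbˢ-· c₁ s₂))

  symbᵗ-⌜⌝ : ∀ {ν} {R : Sym → Set} (s : Lin ν) → All R (symbˢ s) → All R (symbᵗ ⌜ s ⌝)
  symbᵗ-⌜⌝ []      rs = []
  symbᵗ-⌜⌝ (m ∷ s) rs = let (r , rs′) = All.++⁻ (symbᵐ m) rs in All.++⁺ r (symbᵗ-⌜⌝ s rs′)

  -- Not definitional, since coefficients are multiplied by `-1` twice and the bound is complemented
  -- twice. It lets the pivot count as the negation of its own negation.
  negIneq-involutive : ∀ {ν} (ι : Ineq ν) → negIneq (negIneq ι) ≡ ι
  negIneq-involutive (s ≦ c) = cong₂ _≦_ (coeffs s) (complement-involutive c)
    where
    coeffs : ∀ s → (-# 1#) · ((-# 1#) · s) ≡ s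
    coeffs []            = refl
    coeffs ((a , t) ∷ s) = cong₂ _∷_ (cong (_, t) (-1*-involutive a)) (coeffs s)

  ∼-involutive : ∀ ℓ → ∼ (∼ ℓ) ≡ ℓ
  ∼-involutive (eq _ _)  = refl
  ∼-involutive (neq _ _) = refl
  ∼-involutive (ineq ι)  = cong ineq (negIneq-involutive ι)
  ∼-involutive (pos _)   = refl
  ∼-involutive (neg _)   = refl

  -- R need only hold away from the substituted variable.
  module _ {σ} (x : Name) (r : Term σ) {R : Sym → Set} (r-ok : All R (symbᵗ r)) where
    open Substitution x r

    Ok : Sym → Set
    Ok z = Sym.var σ x ≡ z ⊎ R z

    mutual
      symbᵗ-subst : ∀ {τ} (t : Term τ) → All Ok (symbᵗ t) → All R (symbᵗ (substᵗ t))
      symbᵗ-subst (var {τ} y) (ok ∷ []) with σ ≟ˢ τ | x ≟ᴺ y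
      ... | yes refl | yes _  = r-ok
      ... | yes refl | no x≢y = [ (λ e → contradiction (proj₂ (var-injective e)) x≢y) , id ]′ ok ∷ []
      ... | no σ≢τ   | _      = [ (λ e → contradiction (proj₁ (var-injective e)) σ≢τ) , id ]′ ok ∷ []
      symbᵗ-subst (app f ts) (ok ∷ oks) = [ (λ ()) , id ]′ ok ∷ symbᵗˢ-subst ts oks
      symbᵗ-subst (const _)  oks = []
      symbᵗ-subst (t ⊕ u)    oks = let (l , r) = All.++⁻ (symbᵗ t) oks in
        All.++⁺ (symbᵗ-subst t l) (symbᵗ-subst u r)
      symbᵗ-subst (_ ⊙ t)    oks = symbᵗ-subst t oks
      symbᵗ-subst ⌊ t ÷ _ ⌋  oks = symbᵗ-subst t oks

      symbᵗˢ-subst : ∀ {τs} (ts : All Term τs) → All Ok (symbᵗˢ ts) → All R (symbᵗˢ (substᵗˢ ts))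
      symbᵗˢ-subst []       oks = []
      symbᵗˢ-subst (t ∷ ts) oks = let (l , r) = All.++⁻ (symbᵗ t) oks in
        All.++⁺ (symbᵗ-subst t l) (symbᵗˢ-subst ts r)

    symbˢ-subst : ∀ {ν} (s : Lin ν) → All Ok (symbˢ s) →
                  All R (symbˢ (map (λ m → proj₁ m , substᵗ (proj₂ m)) s))
    symbˢ-subst []      oks = []
    symbˢ-subst (m ∷ s) oks = let (l , r) = All.++⁻ (symbᵐ m) oks in
      All.++⁺ (symbᵗ-subst (proj₂ m) l) (symbˢ-subst s r)

    symbˡ-subst : ∀ ℓ → All Ok (symbˡ ℓ) → All R (symbˡ (substˡ ℓ))
    symbˡ-subst (eq t u)  oks = let (l , r) = All.++⁻ (symbᵗ t) oks in
      All.++⁺ (symbᵗ-subst t l) (symbᵗ-subst u r)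
    symbˡ-subst (neq t u) oks = let (l , r) = All.++⁻ (symbᵗ t) oks in
      All.++⁺ (symbᵗ-subst t l) (symbᵗ-subst u r)
    symbˡ-subst (ineq (s ≦ _)) oks = symbˢ-subst s oks
    symbˡ-subst (pos t) oks = symbᵗ-subst t oks
    symbˡ-subst (neg t) oks = symbᵗ-subst t oks

    lits-subst : ∀ F → All (All Ok ∘ symbˡ) (lits F) → All (All R ∘ symbˡ) (lits (F ⟨ x ≔ r ⟩))
    lits-subst (lit ℓ)  (ok ∷ []) = symbˡ-subst ℓ ok ∷ []
    lits-subst ⊤ⁿ       oks = []
    lits-subst ⊥ⁿ       oks = []
    lits-subst (F ∧ⁿ G) oks = let (l , r) = All.++⁻ (lits F) oks in
      All.++⁺ (lits-subst F l) (lits-subst G r)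
    lits-subst (F ∨ⁿ G) oks = let (l , r) = All.++⁻ (lits F) oks in
      All.++⁺ (lits-subst F l) (lits-subst G r)

  -- Together with `indices` this names the local pieces of the integer `F₃`, which unfolds
  -- definitionally to the disjunction of these formulae.
  disjunct : (c : ℤ) → Positive {int} c → Lin int → (F₁ F₂ : Term (num int) → Plain) → ℕ → Plain
  disjunct c c>0 s F₁ F₂ i = F₁ (q ⊕ ⊖ const (+ i)) ∧ⁿ F₂ (const (+ i) ⊕ ⊖ q)
    where
    instance
      c≢0 : ℕ.NonZero ∣ c ∣
      c≢0 = ∣pos∣-nonZero c c>0
    q : Term (num int)
    q = ⌊ ⊖ ⌜ s ⌝ ÷ ∣ c ∣ ⌋

  indices : (c : ℤ) → Positive {int} c → ℤ → List ℕ
  indices c c>0 k = upTo (suc ∣ ⌈ k ℤ.+ 1ℤ / ∣ c ∣ ⌉ ∣)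
    where
    instance
      c≢0 : ℕ.NonZero ∣ c ∣
      c≢0 = ∣pos∣-nonZero c c>0

  lits-F₃ : ∀ {ν} {R : Sym → Set} (c₁ c₂ : Num ν) (c₁>0 : Positive c₁) s₁ s₂ k₁ {F₁ F₂} →
            (∀ t → All R (symbᵗ t) → All (All R ∘ symbˡ) (lits (F₁ t))) →
            (∀ t → All R (symbᵗ t) → All (All R ∘ symbˡ) (lits (F₂ t))) →
            All R (symbˢ s₁) → All R (symbˢ s₂) →
            All (All R ∘ symbˡ) (lits (F₃ c₁ c₂ c₁>0 s₁ s₂ k₁ F₁ F₂))
  lits-F₃ {int} {R} c₁ c₂ c₁>0 s₁ s₂ k₁ {F₁} {F₂} F₁-ok F₂-ok s₁-ok s₂-ok =
    disjuncts (indices c₁ c₁>0 k₁)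
    where
    q-ok : ∀ {zs} → All R zs → All R (symbᵗ ⌜ s₁ ⌝ ++ zs)
    q-ok = All.++⁺ (symbᵗ-⌜⌝ s₁ s₁-ok)
    disjuncts : ∀ is → All (All R ∘ symbˡ) (lits (⋁ⁿ (map (disjunct c₁ c₁>0 s₁ F₁ F₂) is)))
    disjuncts []       = []
    disjuncts (i ∷ is) =
      All.++⁺ (All.++⁺ (F₁-ok _ (q-ok [])) (F₂-ok _ (symbᵗ-⌜⌝ s₁ s₁-ok))) (disjuncts is)
  lits-F₃ {real} c₁ c₂ c₁>0 s₁ s₂ k=-ε F₁-ok F₂-ok s₁-ok s₂-ok = F₂-ok _ (symbᵗ-⌜⌝ s₁ s₁-ok)
  lits-F₃ {real} {R} c₁ c₂ c₁>0 s₁ s₂ k=0 F₁-ok F₂-ok s₁-ok s₂-ok =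
    subst (All R) (sym (symbˢ-s₃ c₁ c₂ s₁ s₂)) (All.++⁺ s₁-ok s₂-ok) ∷
    All.++⁺ (F₁-ok _ (symbᵗ-⌜⌝ s₁ s₁-ok)) (F₂-ok _ (symbᵗ-⌜⌝ s₁ s₁-ok))

  -- Coincidence, update and substitution lemmas.

  module _ (M : Structure) where
    open Structure M

    AgreeAt : (ρ ρ′ : Valuation M) → Sym → Set
    AgreeAt ρ ρ′ (fun _)   = ⊤
    AgreeAt ρ ρ′ (var σ x) = ρ σ x ≡ ρ′ σ x

    module _ {ρ ρ′ : Valuation M} where
      mutual
        evalᵗ-cong : ∀ {σ} (t : Term σ) → All (AgreeAt ρ ρ′) (symbᵗ t) → evalᵗ M ρ t ≡ evalᵗ M ρ′ t
        evalᵗ-cong (var x)    (a ∷ []) = a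
        evalᵗ-cong (app f ts) (_ ∷ as) = cong ⟦ f ⟧ᶠ (evalᵗˢ-cong ts as)
        evalᵗ-cong (const _)  as = refl
        evalᵗ-cong (t ⊕ u)    as = let (l , r) = All.++⁻ (symbᵗ t) as in
          cong₂ _+#_ (evalᵗ-cong t l) (evalᵗ-cong u r)
        evalᵗ-cong (c ⊙ t)    as = cong (c *#_) (evalᵗ-cong t as)
        evalᵗ-cong ⌊ t ÷ k ⌋  as = cong (ℤ._/ℕ k) (evalᵗ-cong t as)

        evalᵗˢ-cong : ∀ {σs} (ts : All Term σs) → All (AgreeAt ρ ρ′) (symbᵗˢ ts) →
                      evalᵗˢ M ρ ts ≡ evalᵗˢ M ρ′ ts
        evalᵗˢ-cong []       as = refl
        evalᵗˢ-cong (t ∷ ts) as = let (l , r) = All.++⁻ (symbᵗ t) as in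
          cong₂ _∷_ (evalᵗ-cong t l) (evalᵗˢ-cong ts r)

      evalˢ-cong : ∀ {ν} (s : Lin ν) → All (AgreeAt ρ ρ′) (symbˢ s) → evalˢ M ρ s ≡ evalˢ M ρ′ s
      evalˢ-cong s as = evalᵗ-cong ⌜ s ⌝ (symbᵗ-⌜⌝ s as)

      holdsˡ-cong : ∀ ℓ → All (AgreeAt ρ ρ′) (symbˡ ℓ) → holdsˡ M ρ ℓ ≡ holdsˡ M ρ′ ℓ
      holdsˡ-cong (eq t u)  as = let (l , r) = All.++⁻ (symbᵗ t) as in
        cong₂ _≡_ (evalᵗ-cong t l) (evalᵗ-cong u r)
      holdsˡ-cong (neq t u) as = let (l , r) = All.++⁻ (symbᵗ t) as in
        cong ¬_ (cong₂ _≡_ (evalᵗ-cong t l) (evalᵗ-cong u r))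
      holdsˡ-cong (ineq (s ≦ c)) as = cong (_≤ᵇ c) (evalˢ-cong s as)
      holdsˡ-cong (pos t) as = cong (_≡ _) (evalᵗ-cong t as)
      holdsˡ-cong (neg t) as = cong (_≡ _) (evalᵗ-cong t as)

      -- An equality of types rather than an implication, so that negation is covered by congruence.
      holds-cong : ∀ φ → All (AgreeAt ρ ρ′) (symb φ) → holds M ρ φ ≡ holds M ρ′ φ
      holds-cong (lit ℓ)  as = holdsˡ-cong ℓ as
      holds-cong ⊤ᶠ       as = refl
      holds-cong ⊥ᶠ       as = refl
      holds-cong (¬ᶠ φ)   as = cong ¬_ (holds-cong φ as)
      holds-cong (φ ∧ᶠ ψ) as = let (l , r) = All.++⁻ (symb φ) as in
        cong₂ _×_ (holds-cong φ l) (holds-cong ψ r)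
      holds-cong (φ ∨ᶠ ψ) as = let (l , r) = All.++⁻ (symb φ) as in
        cong₂ _⊎_ (holds-cong φ l) (holds-cong ψ r)

      plain-cong : ∀ F → All (All (AgreeAt ρ ρ′) ∘ symbˡ) (lits F) →
                   holds M ρ (plain F) ≡ holds M ρ′ (plain F)
      plain-cong (lit ℓ)  (a ∷ []) = holdsˡ-cong ℓ a
      plain-cong ⊤ⁿ       as = refl
      plain-cong ⊥ⁿ       as = refl
      plain-cong (F ∧ⁿ G) as = let (l , r) = All.++⁻ (lits F) as in
        cong₂ _×_ (plain-cong F l) (plain-cong G r)
      plain-cong (F ∨ⁿ G) as = let (l , r) = All.++⁻ (lits F) as in
        cong₂ _⊎_ (plain-cong F l) (plain-cong G r)

      -- Holes occur positively.
      fill-mono : ∀ (I : Context) {χ χ′} → All (AgreeAt ρ ρ′) (symbᶜ I) →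
                  (holds M ρ ⟪ χ ⟫ → holds M ρ′ ⟪ χ′ ⟫) →
                  holds M ρ ⟪ I [ χ ] ⟫ → holds M ρ′ ⟪ I [ χ′ ] ⟫
      fill-mono I {χ} {χ′} as f = let (l , p) = symbⁿ⁻ I as in go I l p
        where
        go : ∀ (I : Context) → All (All (AgreeAt ρ ρ′) ∘ symbˡ) (lits I) →
             All (All (AgreeAt ρ ρ′) ∘ maybe symbᴸᴬ []) (leaves I) →
             holds M ρ ⟪ I [ χ ] ⟫ → holds M ρ′ ⟪ I [ χ′ ] ⟫
        go (lit ℓ) (a ∷ []) _ h = subst id (holdsˡ-cong ℓ a) h
        go ⊤ⁿ _ _ h = h
        go ⊥ⁿ _ _ h = h
        go (φ ∧ⁿ ψ) l p (h , h′) =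
          let (lφ , lψ) = All.++⁻ (lits φ) l; (pφ , pψ) = All.++⁻ (leaves φ) p in
          go φ lφ pφ h , go ψ lψ pψ h′
        go (φ ∨ⁿ ψ) l p h =
          let (lφ , lψ) = All.++⁻ (lits φ) l; (pφ , pψ) = All.++⁻ (leaves φ) p in
          [ inj₁ ∘ go φ lφ pφ , inj₂ ∘ go ψ lψ pψ ]′ h
        go (leaf (just (mkLA s _ F))) _ (a ∷ []) h =
          subst id (plain-cong F (symbᵖ⁻ F (All.++⁻ʳ (symbˢ s) a))) h
        go (leaf nothing) _ _ h = f h

    evalˢ-++ : ∀ {ν} ρ (s t : Lin ν) → evalˢ M ρ (s ++ t) ≡ evalˢ M ρ s +# evalˢ M ρ t
    evalˢ-++ ρ []      t = sym (+#-identityˡ _)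
    evalˢ-++ ρ (m ∷ s) t = trans (cong (_ +#_) (evalˢ-++ ρ s t)) (sym (+#-assoc _ _ _))

    evalˢ-· : ∀ {ν} ρ (c : Num ν) (s : Lin ν) → evalˢ M ρ (c · s) ≡ c *# evalˢ M ρ s
    evalˢ-· ρ c []            = sym (*#-zeroʳ c)
    evalˢ-· ρ c ((a , t) ∷ s) = trans
      (cong₂ _+#_ (*#-assoc c a _) (evalˢ-· ρ c s)) (sym (*#-distribˡ-+# c _ _))

    evalˢ-s₃ : ∀ {ν} ρ (c₁ c₂ : Num ν) s₁ s₂ →
               evalˢ M ρ (s₃ c₁ c₂ s₁ s₂) ≡ c₂ *# evalˢ M ρ s₁ +# c₁ *# evalˢ M ρ s₂
    evalˢ-s₃ ρ c₁ c₂ s₁ s₂ = trans (evalˢ-++ ρ (c₂ · s₁) (c₁ · s₂))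
      (cong₂ _+#_ (evalˢ-· ρ c₂ s₁) (evalˢ-· ρ c₁ s₂))

    update : ∀ σ → Valuation M → Name → ⟦ σ ⟧ˢ → Valuation M
    update σ ρ x v τ y with σ ≟ˢ τ | x ≟ᴺ y
    ... | yes refl | yes _ = v
    ... | yes refl | no _  = ρ τ y
    ... | no _     | _     = ρ τ y

    update-same : ∀ σ ρ x (v : ⟦ σ ⟧ˢ) → update σ ρ x v σ x ≡ v
    update-same σ ρ x v with σ ≟ˢ σ | x ≟ᴺ x
    ... | yes refl | yes _  = refl
    ... | yes refl | no x≢x = contradiction refl x≢x
    ... | no σ≢σ   | _      = contradiction refl σ≢σ

    update-agree : ∀ σ ρ x (v : ⟦ σ ⟧ˢ) {z} → Sym.var σ x ≢ z → AgreeAt ρ (update σ ρ x v) z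
    update-agree σ ρ x v {fun _} _ = tt
    update-agree σ ρ x v {var τ y} ≢z with σ ≟ˢ τ | x ≟ᴺ y
    ... | yes refl | yes refl = contradiction refl ≢z
    ... | yes refl | no _     = refl
    ... | no _     | _        = refl

    update-agrees : ∀ σ ρ x (v : ⟦ σ ⟧ˢ) {zs} → Sym.var σ x ∉ zs → All (AgreeAt ρ (update σ ρ x v)) zs
    update-agrees σ ρ x v x∉zs = All.map (λ {z} → update-agree σ ρ x v {z}) (All.¬Any⇒All¬ _ x∉zs)

    module _ {σ} (x : Name) (r : Term σ) (ρ : Valuation M) where
      open Substitution x r

      ρ[r] : Valuation M
      ρ[r] = update σ ρ x (evalᵗ M ρ r)

      mutual
        -- `substᵗ` and `update` branch on the same two tests, so each variable case computes on
        -- both sides at once.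
        evalᵗ-subst : ∀ {τ} (t : Term τ) → evalᵗ M ρ (substᵗ t) ≡ evalᵗ M ρ[r] t
        evalᵗ-subst (var {τ} y) with σ ≟ˢ τ | x ≟ᴺ y
        ... | yes refl | yes _ = refl
        ... | yes refl | no _  = refl
        ... | no _     | _     = refl
        evalᵗ-subst (app f ts) = cong ⟦ f ⟧ᶠ (evalᵗˢ-subst ts)
        evalᵗ-subst (const _)  = refl
        evalᵗ-subst (t ⊕ u)    = cong₂ _+#_ (evalᵗ-subst t) (evalᵗ-subst u)
        evalᵗ-subst (c ⊙ t)    = cong (c *#_) (evalᵗ-subst t)
        evalᵗ-subst ⌊ t ÷ k ⌋  = cong (ℤ._/ℕ k) (evalᵗ-subst t)

        evalᵗˢ-subst : ∀ {τs} (ts : All Term τs) → evalᵗˢ M ρ (substᵗˢ ts) ≡ evalᵗˢ M ρ[r] ts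
        evalᵗˢ-subst []       = refl
        evalᵗˢ-subst (t ∷ ts) = cong₂ _∷_ (evalᵗ-subst t) (evalᵗˢ-subst ts)

      evalˢ-subst : ∀ {ν} (s : Lin ν) →
                    evalˢ M ρ (map (λ m → proj₁ m , substᵗ (proj₂ m)) s) ≡ evalˢ M ρ[r] s
      evalˢ-subst []            = refl
      evalˢ-subst ((c , t) ∷ s) = cong₂ _+#_ (cong (c *#_) (evalᵗ-subst t)) (evalˢ-subst s)

      holdsˡ-subst : ∀ ℓ → holdsˡ M ρ (substˡ ℓ) ≡ holdsˡ M ρ[r] ℓ
      holdsˡ-subst (eq t u)       = cong₂ _≡_ (evalᵗ-subst t) (evalᵗ-subst u)
      holdsˡ-subst (neq t u)      = cong ¬_ (cong₂ _≡_ (evalᵗ-subst t) (evalᵗ-subst u))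
      holdsˡ-subst (ineq (s ≦ c)) = cong (_≤ᵇ c) (evalˢ-subst s)
      holdsˡ-subst (pos t)        = cong (_≡ _) (evalᵗ-subst t)
      holdsˡ-subst (neg t)        = cong (_≡ _) (evalᵗ-subst t)

      plain-subst : ∀ F → holds M ρ (plain (F ⟨ x ≔ r ⟩)) ≡ holds M ρ[r] (plain F)
      plain-subst (lit ℓ)  = holdsˡ-subst ℓ
      plain-subst ⊤ⁿ       = refl
      plain-subst ⊥ⁿ       = refl
      plain-subst (F ∧ⁿ G) = cong₂ _×_ (plain-subst F) (plain-subst G)
      plain-subst (F ∨ⁿ G) = cong₂ _⊎_ (plain-subst F) (plain-subst G)

    plain-⋁⁺ : ∀ {X : Set} {ρ} {f : X → Plain} {xs} →
               Any (λ x → holds M ρ (plain (f x))) xs → holds M ρ (plain (⋁ⁿ (map f xs)))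
    plain-⋁⁺ (here h)  = inj₁ h
    plain-⋁⁺ (there h) = inj₂ (plain-⋁⁺ h)

    plain-⋁⁻ : ∀ {X : Set} {ρ} {f : X → Plain} xs →
               holds M ρ (plain (⋁ⁿ (map f xs))) → ∃ λ x → holds M ρ (plain (f x))
    plain-⋁⁻ (x ∷ xs) (inj₁ h) = x , h
    plain-⋁⁻ (x ∷ xs) (inj₂ h) = plain-⋁⁻ xs h

    -- `F₃` as elimination of the pivot's variable.

    module _ (ρ : Valuation M) where

      -- Semantic rather than syntactic substitution: a split point need not be given as the value
      -- of a term, and `plain-subst` enters only at the terms tested by `F₃`.
      At : ∀ {ν} → Name → Plain → Num ν → Set
      At {ν} x F v = holds M (update (num ν) ρ x v) (plain F)

      At⁺ : ∀ {ν x} {r : Term (num ν)} F →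
            holds M ρ (plain (F ⟨ x ≔ r ⟩)) → At x F (evalᵗ M ρ r)
      At⁺ {x = x} {r} F = subst id (plain-subst x r ρ F)

      At⁻ : ∀ {ν x} {r : Term (num ν)} F →
            At x F (evalᵗ M ρ r) → holds M ρ (plain (F ⟨ x ≔ r ⟩))
      At⁻ {x = x} {r} F = subst id (sym (plain-subst x r ρ F))

      -- Each way for `F₃` to hold carries its point: `q - i` for the integer disjunct `i`,
      -- `-s₁ / c₁` over the rationals, and a value strictly inside the gap if only `s₃ < 0` is
      -- known.
      F₃⇒split : ∀ {ν} {c₁ c₂ : Num ν} (c₁>0 : Positive c₁) → Positive c₂ → ∀ {s₁ s₂ k₁ k₂ x₁ x₂ F₁ F₂} →
        Cut c₁ (evalˢ M ρ s₁) k₁ (At x₁ F₁) → Cut c₂ (evalˢ M ρ s₂) k₂ (At x₂ F₂) →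
        holds M ρ (plain (F₃ c₁ c₂ c₁>0 s₁ s₂ k₁ (λ t → F₁ ⟨ x₁ ≔ t ⟩) (λ t → F₂ ⟨ x₂ ≔ t ⟩))) →
        Split {ν} (At x₁ F₁) (At x₂ F₂)
      F₃⇒split {int} {c₁} c₁>0 c₂>0 {s₁} {k₁ = k₁} {x₁ = x₁} {x₂} {F₁} {F₂} cut₁ cut₂ h
        with plain-⋁⁻ {ρ = ρ} {disjunct c₁ c₁>0 s₁ (λ t → F₁ ⟨ x₁ ≔ t ⟩) (λ t → F₂ ⟨ x₂ ≔ t ⟩)}
               (indices c₁ c₁>0 k₁) h
      ... | i , h₁ , h₂ = IntegerSplit.toSplit c₁>0 c₂>0 cut₁ cut₂ {i}
        (At⁺ F₁ h₁ , At⁺ F₂ h₂)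
      F₃⇒split {real} c₁>0 c₂>0 {k₁ = k=-ε} {x₂ = x₂} {F₂ = F₂} cut₁ cut₂ h =
        RealSplit.split-at-q c₁>0 c₂>0 cut₁ cut₂ ℚ.≤-refl (At⁺ F₂ h)
      F₃⇒split {real} {c₁} {c₂} c₁>0 c₂>0 {s₁} {s₂} {k₁ = k=0} cut₁ cut₂ (inj₁ s₃<0) =
        RealSplit.split-dense c₁>0 c₂>0 cut₁ cut₂ (subst (ℚ._< 0ℚ) (evalˢ-s₃ ρ c₁ c₂ s₁ s₂) s₃<0)
      F₃⇒split {real} c₁>0 c₂>0 {k₁ = k=0} {x₁ = x₁} {x₂} {F₁} {F₂} cut₁ cut₂ (inj₂ (h₁ , h₂)) =
        RealSplit.toSplit c₁>0 c₂>0 cut₁ cut₂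
          (At⁺ F₁ h₁ , At⁺ F₂ h₂)

      split⇒F₃ : ∀ {ν} {c₁ c₂ : Num ν} (c₁>0 : Positive c₁) → Positive c₂ → ∀ {s₁ s₂ k₁ k₂ x₁ x₂ F₁ F₂} →
        Cut c₁ (evalˢ M ρ s₁) k₁ (At x₁ F₁) → Cut c₂ (evalˢ M ρ s₂) k₂ (At x₂ F₂) →
        Split {ν} (At x₁ F₁) (At x₂ F₂) →
        holds M ρ (plain (F₃ c₁ c₂ c₁>0 s₁ s₂ k₁ (λ t → F₁ ⟨ x₁ ≔ t ⟩) (λ t → F₂ ⟨ x₂ ≔ t ⟩)))
      split⇒F₃ {int} {c₁} c₁>0 c₂>0 {s₁} {x₁ = x₁} {x₂} {F₁} {F₂} cut₁ cut₂ sp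
        with IntegerSplit.fromSplit c₁>0 c₂>0 cut₁ cut₂ sp
      ... | i , i≤N , h₁ , h₂ =
        plain-⋁⁺ {ρ = ρ} {disjunct c₁ c₁>0 s₁ (λ t → F₁ ⟨ x₁ ≔ t ⟩) (λ t → F₂ ⟨ x₂ ≔ t ⟩)}
          (lose (∈-upTo⁺ i≤N)
        (At⁻ F₁ h₁ , At⁻ F₂ h₂))
      split⇒F₃ {real} c₁>0 c₂>0 {k₁ = k=-ε} {x₂ = x₂} {F₂ = F₂} cut₁ cut₂ sp =
        At⁻ F₂ (RealSplit.P₂-at-q c₁>0 c₂>0 cut₁ cut₂ sp)
      split⇒F₃ {real} {c₁} {c₂} c₁>0 c₂>0 {s₁} {s₂} {k₁ = k=0} {x₁ = x₁} {x₂} {F₁} {F₂} cut₁ cut₂ sp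
        with RealSplit.fromSplit c₁>0 c₂>0 cut₁ cut₂ sp
      ... | inj₁ s₃<0 = inj₁ (subst (ℚ._< 0ℚ) (sym (evalˢ-s₃ ρ c₁ c₂ s₁ s₂)) s₃<0)
      ... | inj₂ (h₁ , h₂) = inj₂
        (At⁻ F₁ h₁ , At⁻ F₂ h₂)

-- Projections and freshness of auxiliary variables.

module Resolution (S : Signature) (N : Logic.AuxNaming S) (mode : SharedMode)
                  (A B : Logic.Formula S) where

  open Logic S
  open Semantics S
  open Interpolation S N mode A B

  auxSym : ∀ {ν} → Ineq ν → Sym
  auxSym {ν} ι = var (num ν) (aux (ineqKey ι))

  -- `aux-injective` compares keys of one sort only; across sorts the symbols already differ, which
  -- is why pairs of a sort and a key are equated.
  auxSym-injective : ∀ {σ τ} {κ : AuxKey σ} {κ′ : AuxKey τ} →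
                     Sym.var σ (aux κ) ≡ var τ (aux κ′) → _≡_ {A = ∃ AuxKey} (σ , κ) (τ , κ′)
  auxSym-injective e with var-injective e
  ... | refl , e′ = cong (_ ,_) (aux-injective e′)

  auxSym∉auxOfMixed : ∀ {ν} (ι : Ineq ν) ℓ → ℓ ≢ ineq ι → All (auxSym ι ≢_) (auxOfMixed ℓ)
  auxSym∉auxOfMixed ι (eq _ _)  _  = (λ e → case auxSym-injective e of λ ()) ∷ []
  auxSym∉auxOfMixed ι (neq _ _) _  =
    (λ e → case auxSym-injective e of λ ()) ∷ (λ e → case auxSym-injective e of λ ()) ∷ []
  auxSym∉auxOfMixed ι (ineq _)  ≢ι = (λ e → ≢ι (same-literal (auxSym-injective e))) ∷ []
    where
    same-literal : ∀ {ν μ} {ι : Ineq ν} {ι′ : Ineq μ} →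
                   _≡_ {A = ∃ AuxKey} (num ν , ineqKey ι) (num μ , ineqKey ι′) → ineq ι′ ≡ ineq ι
    same-literal refl = refl
  auxSym∉auxOfMixed ι (pos _)   _  = []
  auxSym∉auxOfMixed ι (neg _)   _  = []

  auxOf-ineq : ∀ {ν} (ι : Ineq ν) {z} → z ∈ auxOf (ineq ι) → auxSym ι ≡ z
  auxOf-ineq ι z∈ with locality (symbˡ (ineq ι)) | z∈
  ... | mixed | here e = sym e

  orient-cases : ∀ {σ} (t u : Term σ) → orient t u ≡ (t , u) ⊎ orient t u ≡ (u , t)
  orient-cases t u with locality (symbᵗ t)
  ... | A-local = inj₁ refl
  ... | B-local = inj₂ refl
  ... | shared  = inj₂ refl
  ... | mixed   = inj₂ refl

  module _ {R : Sym → Set} where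

    symb-orient : ∀ {σ} (t u : Term σ) → All R (symbᵗ t ++ symbᵗ u) →
                  let (a , b) = orient t u in All R (symbᵗ a) × All R (symbᵗ b)
    symb-orient t u rs with orient t u | orient-cases t u | All.++⁻ (symbᵗ t) rs
    ... | _ | inj₁ refl | rt , ru = rt , ru
    ... | _ | inj₂ refl | rt , ru = ru , rt

    symb-projectEq : ∀ {σ} side (a b : Term σ) → All R (symbᵗ a) → All R (symbᵗ b) →
                     R (var σ (aux (eqKey a b))) → All R (symb (projectEq side a b))
    symb-projectEq A-side a b ra rb r = All.++⁺ ra (r ∷ [])
    symb-projectEq B-side a b ra rb r = r ∷ rb

    symb-projectNeq : ∀ {σ} side (a b : Term σ) → All R (symb (projectEq side a b)) →
                      R (var bool (aux (neqKey a b))) → All R (symb (projectNeq side a b))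
    symb-projectNeq A-side a b rs r = All.++⁺ (r ∷ rs) (r ∷ rs)
    symb-projectNeq B-side a b rs r = All.++⁺ (r ∷ rs) (r ∷ rs)

    symbˢ-filter : ∀ {ν} {P : Monomial ν → Set} (P? : Decidable P) s →
                   All R (symbˢ s) → All R (symbˢ (filter P? s))
    symbˢ-filter P? s rs = concatMap⁺ {f = symbᵐ} (All.filter⁺ P? (concatMap⁻ {f = symbᵐ} {s} rs))

    symb-projectIneq : ∀ {ν} side (ι : Ineq ν) → All R (symbˢ (Ineq.lhs ι)) → R (auxSym ι) →
                       All R (symb (projectIneq side ι))
    symb-projectIneq A-side (s ≦ c) rs r =
      subst (All R) (sym (List.concatMap-++ symbᵐ (A-part s) _)) (All.++⁺ (symbˢ-filter _ s rs) (r ∷ []))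
    symb-projectIneq B-side (s ≦ c) rs r = r ∷ symbˢ-filter _ s rs

    symb-projectMixed : ∀ side ℓ → All R (symbˡ ℓ) → All R (auxOfMixed ℓ) →
                        All R (symb (projectMixed side ℓ))
    symb-projectMixed side (eq t u)  rs (r ∷ []) =
      let (ra , rb) = symb-orient t u rs in symb-projectEq side _ _ ra rb r
    symb-projectMixed side (neq t u) rs (r ∷ r′ ∷ []) =
      let (ra , rb) = symb-orient t u rs in symb-projectNeq side _ _ (symb-projectEq side _ _ ra rb r) r′
    symb-projectMixed side (ineq ι)  rs (r ∷ []) = symb-projectIneq side ι rs r
    symb-projectMixed side (pos _)   rs _ = []
    symb-projectMixed side (neg _)   rs _ = []

    symb-sharedOnA : ∀ mode ℓ → All R (symbˡ ℓ) → All R (symb (sharedOnA mode ℓ))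
    symb-sharedOnA pudlák   ℓ rs = rs
    symb-sharedOnA mcMillan ℓ rs = []

    symb-project : ∀ side ℓ → All R (symbˡ ℓ) → All R (auxOfMixed ℓ) → All R (symb (project side ℓ))
    symb-project side ℓ rs rx with locality (symbˡ ℓ) | side
    ... | A-local | A-side = rs
    ... | A-local | B-side = []
    ... | B-local | A-side = []
    ... | B-local | B-side = rs
    ... | shared  | A-side = symb-sharedOnA mode ℓ rs
    ... | shared  | B-side = rs
    ... | mixed   | side′  = symb-projectMixed side′ ℓ rs rx

  symbˡ-∼ : ∀ ℓ → symbˡ (∼ ℓ) ≡ symbˡ ℓ
  symbˡ-∼ (eq _ _)       = refl
  symbˡ-∼ (neq _ _)      = refl
  symbˡ-∼ (ineq (s ≦ _)) = symbˢ-· (-# 1#) s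
  symbˡ-∼ (pos _)        = refl
  symbˡ-∼ (neg _)        = refl

  -- The variable could enter only as a symbol of a literal, which `AuxFree` excludes, or as the
  -- auxiliary variable of some `∼ ℓ` equal to `ineq ι`, and then `ℓ` would be `∼ ineq ι`.
  auxSym∉negClause : ∀ {ν} (ι : Ineq ν) side C → All (AuxFree ∘ symbˡ) C → (∼ ineq ι) ∉ C →
                     All (auxSym ι ≢_) (symb (negClause side C))
  auxSym∉negClause ι side []      _               _    = []
  auxSym∉negClause ι side (ℓ ∷ C) (ℓ-free ∷ free) ∼ι∉C = All.++⁺
    (symb-project side (∼ ℓ)
      (subst (All (auxSym ι ≢_)) (sym (symbˡ-∼ ℓ)) (All.¬Any⇒All¬ _ (ℓ-free (ineqKey ι))))
      (auxSym∉auxOfMixed ι (∼ ℓ)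
        (λ ∼ℓ≡ι → ∼ι∉C (here (trans (cong ∼_ (sym ∼ℓ≡ι)) (∼-involutive ℓ))))))
    (auxSym∉negClause ι side C free (∼ι∉C ∘ there))

  project-mixed : ∀ {ν} side (ι : Ineq ν) → Mixed (ineq ι) → project side (ineq ι) ≡ projectIneq side ι
  project-mixed side ι ι-mixed = cong (λ l → projectAs l side (ineq ι)) ι-mixed

  -- The locality of a monomial depends on its term and not on its coefficient.
  filter-· : ∀ {ν} {P : List Sym → Set} (P? : Decidable P) (c : Num ν) s →
             filter (P? ∘ symbᵐ) (c · s) ≡ c · filter (P? ∘ symbᵐ) s
  filter-· P? c []      = refl
  filter-· P? c (m ∷ s) with does (P? (symbᵐ m))
  ... | true  = cong (_ ∷_) (filter-· P? c s)
  ... | false = filter-· P? c s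

  ⊒-refl : ∀ {M ρ} → M ∋ ρ ⊒ ρ
  ⊒-refl = record { above = λ _ → ≤#-refl ; same = λ _ _ _ → refl }

  -- Serves two purposes: with equal valuations it gives antitonicity in the pivot's variable, with
  -- equal values it carries a split point along when the other auxiliary variables decrease.
  update-⊒ : ∀ {M ρ ρ′ ν} (ι : Ineq ν) {v v′ : Num ν} → M ∋ ρ ⊒ ρ′ → v′ ≤# v →
             M ∋ update M (num ν) ρ (aux (ineqKey ι)) v ⊒ update M (num ν) ρ′ (aux (ineqKey ι)) v′
  update-⊒ {M} {ρ} {ρ′} {ν} ι {v} {v′} ρ⊒ρ′ v′≤v = record { above = above′ ; same = same′ }
    where
    open _∋_⊒_ ρ⊒ρ′
    x = aux (ineqKey ι)
    above′ : ∀ {μ} (ι′ : Ineq μ) → let y = aux (ineqKey ι′) in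
             update M (num ν) ρ′ x v′ (num μ) y ≤# update M (num ν) ρ x v (num μ) y
    above′ {μ} ι′ with auxSym ι ≟ʸ auxSym ι′
    ... | no ≢ = subst₂ _≤#_
      (update-agree M (num ν) ρ′ x v′ ≢) (update-agree M (num ν) ρ x v ≢) (above ι′)
    ... | yes e with auxSym-injective e
    ... | refl = subst₂ _≤#_
      (sym (update-same M (num ν) ρ′ x v′)) (sym (update-same M (num ν) ρ x v)) v′≤v
    same′ : ∀ σ y → NoIneqAux (var σ y ∷ []) → update M (num ν) ρ x v σ y ≡ update M (num ν) ρ′ x v′ σ y
    same′ σ y y∉ = trans (sym (update-agree M (num ν) ρ x v (y∉ ι ∘ here)))
      (trans (same σ y y∉) (update-agree M (num ν) ρ′ x v′ (y∉ ι ∘ here)))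

  -- The resolvent is again a pattern.

  IsPatternIn : ∀ {ν} → Ineq ν → Num ν → Lin ν → Slack ν → Plain → Set₁
  IsPatternIn ι c s k F = IsPattern (mkLA ((c , var (aux (ineqKey ι))) ∷ s) k F)

  -- Since the variable is absent from `s`, the recorded term is `c v` plus a value independent of
  -- `v`.
  pattern-cut : ∀ {ν} (ι : Ineq ν) {c s k F} → IsPatternIn ι c s k F → auxSym ι ∉ symbˢ s →
                ∀ M ρ → Cut c (evalˢ M ρ s) k (At M ρ (aux (ineqKey ι)) F)
  pattern-cut {ν} ι {c} {s} {k} π x∉s M ρ = record
    { antitone = λ v≤w → monotone M _ _ (update-⊒ ι ⊒-refl v≤w)
    ; bounded  = λ {v} p 0< → bottom M (ρ[ v ]) (subst (0# <#_) (sym (eval v)) 0<) p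
    ; total    = λ {v} <-k → top M (ρ[ v ]) (subst (_<-slack k) (sym (eval v)) <-k)
    }
    where
    open IsPattern π
    x = aux (ineqKey ι)
    ρ[_] : Num ν → Valuation M
    ρ[ v ] = update M (num ν) ρ x v
    eval : ∀ v → evalˢ M ρ[ v ] ((c , var x) ∷ s) ≡ c *# v +# evalˢ M ρ s
    eval v = cong₂ (λ a b → c *# a +# b) (update-same M (num ν) ρ x v)
      (sym (evalˢ-cong M s (update-agrees M (num ν) ρ x v x∉s)))

  ·-linear : ∀ {ν} {c : Num ν} {s} → Positive c → All PatternMonomial s → All PatternMonomial (c · s)
  ·-linear c>0 []       = []
  ·-linear {c = c} c>0 (auxiliary {c′} ι c′>0 ∷ ms) =
    auxiliary ι (pos*pos c c′ c>0 c′>0) ∷ ·-linear c>0 ms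
  ·-linear c>0 (other t-free ∷ ms)    = other t-free ∷ ·-linear c>0 ms

  module Resolvent {ν} (ι₁ ι₂ : Ineq ν) {c₁ c₂ : Num ν} (c₁>0 : Positive c₁) (c₂>0 : Positive c₂)
                   {s₁ s₂ k₁ k₂ F₁ F₂}
                   (pat₁ : IsPatternIn ι₁ c₁ s₁ k₁ F₁) (pat₂ : IsPatternIn ι₂ c₂ s₂ k₂ F₂)
                   (x₁∉s₁ : auxSym ι₁ ∉ symbˢ s₁) (x₂∉s₂ : auxSym ι₂ ∉ symbˢ s₂) where
    private
      module Pat₁ = IsPattern pat₁
      module Pat₂ = IsPattern pat₂
      x₁ = aux (ineqKey ι₁)
      x₂ = aux (ineqKey ι₂)

    F : Plain
    F = F₃ c₁ c₂ c₁>0 s₁ s₂ k₁ (λ t → F₁ ⟨ x₁ ≔ t ⟩) (λ t → F₂ ⟨ x₂ ≔ t ⟩)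

    π₃ : LA
    π₃ = mkLA (s₃ c₁ c₂ s₁ s₂) (k₃ c₁ c₂ k₁ k₂) F

    module _ (M : Structure) (ρ : Valuation M) where

      cut₁ : Cut c₁ (evalˢ M ρ s₁) k₁ (At M ρ x₁ F₁)
      cut₁ = pattern-cut ι₁ pat₁ x₁∉s₁ M ρ

      cut₂ : Cut c₂ (evalˢ M ρ s₂) k₂ (At M ρ x₂ F₂)
      cut₂ = pattern-cut ι₂ pat₂ x₂∉s₂ M ρ

      F⇒split : holds M ρ (plain F) → Split {ν} (At M ρ x₁ F₁) (At M ρ x₂ F₂)
      F⇒split = F₃⇒split M ρ c₁>0 c₂>0 cut₁ cut₂

      split⇒F : Split {ν} (At M ρ x₁ F₁) (At M ρ x₂ F₂) → holds M ρ (plain F)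
      split⇒F = split⇒F₃ M ρ c₁>0 c₂>0 cut₁ cut₂

    symbˢ-π₃ : ∀ {R : Sym → Set} → All R (symbˢ s₁) → All R (symbˢ s₂) → All R (symbˢ (s₃ c₁ c₂ s₁ s₂))
    symbˢ-π₃ r₁ r₂ = subst (All _) (sym (symbˢ-s₃ c₁ c₂ s₁ s₂)) (All.++⁺ r₁ r₂)

    -- Kept generic in `R` for two uses: the `covers` condition and the symbol condition of the
    -- resolvent.
    symbᵖ-F : ∀ {R : Sym → Set} →
              All (λ z → auxSym ι₁ ≡ z ⊎ R z) (symbᵖ F₁) → All (λ z → auxSym ι₂ ≡ z ⊎ R z) (symbᵖ F₂) →
              All R (symbˢ s₁) → All R (symbˢ s₂) → All R (symbᵖ F)
    symbᵖ-F f₁ f₂ r₁ r₂ = symbᵖ⁺ F (lits-F₃ c₁ c₂ c₁>0 s₁ s₂ k₁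
      (λ t r → lits-subst x₁ t r F₁ (symbᵖ⁻ F₁ f₁)) (λ t r → lits-subst x₂ t r F₂ (symbᵖ⁻ F₂ f₂)) r₁ r₂)

    -- `covers` recast as a predicate of single symbols, vacuous off the inequality variables, so
    -- that the symbol lemma for substitution applies to it.
    Covered : Sym → Set
    Covered z = ∀ {μ} (ι : Ineq μ) → auxSym ι ≡ z → z ∈ symbˢ (s₃ c₁ c₂ s₁ s₂)

    -- The substituted variable is the one exempted: only its own monomial is missing from `s₀`, and
    -- the substitution removes it from `F₀`.
    covered : ∀ {ι₀ : Ineq ν} {c₀ : Num ν} {s₀ F₀} →
              (∀ {μ} (ι : Ineq μ) → auxSym ι ∈ symbᵖ F₀ →
                 auxSym ι ∈ symbˢ ((c₀ , var (aux (ineqKey ι₀))) ∷ s₀)) →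
              (∀ {z} → z ∈ symbˢ s₀ → z ∈ symbˢ (s₃ c₁ c₂ s₁ s₂)) →
              All (λ z → auxSym ι₀ ≡ z ⊎ Covered z) (symbᵖ F₀)
    covered {ι₀} {c₀} {s₀} {F₀} cover s₀⊆s₃ = All.tabulate choose
      where
      choose : ∀ {z} → z ∈ symbᵖ F₀ → auxSym ι₀ ≡ z ⊎ Covered z
      choose {z} z∈F₀ with auxSym ι₀ ≟ʸ z
      ... | yes e = inj₁ e
      ... | no ≢z  = inj₂ λ { ι refl → case cover ι z∈F₀ of λ
        { (here e) → contradiction (sym e) ≢z ; (there z∈s₀) → s₀⊆s₃ z∈s₀ } }

    s₁⊆s₃ : ∀ {z} → z ∈ symbˢ s₁ → z ∈ symbˢ (s₃ c₁ c₂ s₁ s₂)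
    s₁⊆s₃ z∈ = subst (_ ∈_) (sym (symbˢ-s₃ c₁ c₂ s₁ s₂)) (∈-++⁺ˡ z∈)

    s₂⊆s₃ : ∀ {z} → z ∈ symbˢ s₂ → z ∈ symbˢ (s₃ c₁ c₂ s₁ s₂)
    s₂⊆s₃ z∈ = subst (_ ∈_) (sym (symbˢ-s₃ c₁ c₂ s₁ s₂)) (∈-++⁺ʳ (symbˢ s₁) z∈)

    linear₃ : All PatternMonomial (s₃ c₁ c₂ s₁ s₂)
    linear₃ = All.++⁺ (·-linear c₂>0 (All.tail Pat₁.linear)) (·-linear c₁>0 (All.tail Pat₂.linear))

    isPattern : IsPattern π₃
    isPattern = record
      { linear     = linear₃
      ; covers     = λ ι y∈F → All.lookup (symbᵖ-F {Covered}
          (covered {ι₁} {c₁} {s₁} {F₁} Pat₁.covers s₁⊆s₃)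
          (covered {ι₂} {c₂} {s₂} {F₂} Pat₂.covers s₂⊆s₃)
          (All.tabulate λ z∈ _ _ → s₁⊆s₃ z∈) (All.tabulate λ z∈ _ _ → s₂⊆s₃ z∈)) y∈F ι refl
      ; admissible = slack-admissible c₁>0 c₂>0 Pat₁.admissible Pat₂.admissible
      -- The split point stays fixed while the remaining auxiliary variables decrease.
      ; monotone   = λ M ρ ρ′ ρ⊒ρ′ h → case F⇒split M ρ h of λ
          { (split p₁ p₂) → split⇒F M ρ′ (split
              (Pat₁.monotone M _ _ (update-⊒ ι₁ ρ⊒ρ′ ≤#-refl) p₁)
              (Pat₂.monotone M _ _ (update-⊒ ι₂ ρ⊒ρ′ ≤#-refl) p₂)) }
      ; bottom     = λ M ρ 0<s₃ h → split-bounded c₁>0 c₂>0 (cut₁ M ρ) (cut₂ M ρ) (F⇒split M ρ h)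
          (subst (0# <#_) (evalˢ-s₃ M ρ c₁ c₂ s₁ s₂) 0<s₃)
      ; top        = λ M ρ s₃<-k₃ → split⇒F M ρ (split-total c₁>0 c₂>0 (cut₁ M ρ) (cut₂ M ρ)
          (subst (_<-slack k₃ c₁ c₂ k₁ k₂) (evalˢ-s₃ M ρ c₁ c₂ s₁ s₂) s₃<-k₃))
      }

  -- What one premise provides on either side.

  SharedOrAux : Clause → Sym → Set
  SharedOrAux C z = (z ∈ symb A × z ∈ symb B) ⊎ Any (λ ℓ → z ∈ auxOf (∼ ℓ)) C

  -- The premise has the clause ¬ι ∨ C, so that it is ι that gets projected.
  module Premise {ν} (ι : Ineq ν) (C : Clause) (ι-mixed : Mixed (ineq ι)) (∼ι∉C : (∼ ineq ι) ∉ C)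
                 (A-free : AuxFree (symb A)) (B-free : AuxFree (symb B))
                 (ι-free : AuxFree (symbˡ (ineq ι))) (C-free : All (AuxFree ∘ symbˡ) C)
                 (I : Context) (I-hole : HasHole I)
                 {c : Num ν} {s : Lin ν} {k : Slack ν} {F : Plain}
                 (x∉I : auxSym ι ∉ symbᶜ I) (x∉s : auxSym ι ∉ symbˢ s)
                 (isPartial : IsPartialInterpolant ((∼ ineq ι) ∷ C)
                   (I [ leaf (mkLA ((c , var (aux (ineqKey ι))) ∷ s) k F) ])) where
    open IsPartialInterpolant isPartial
    private
      x = aux (ineqKey ι)
      lhs = Ineq.lhs ι

    π : LA
    π = mkLA ((c , var x) ∷ s) k F

    isPattern : IsPattern π
    isPattern with hole-leaves I I-hole patterns
    ... | p ∷ [] = p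

    I-patterns : All (MAll.All IsPattern) (leaves I)
    I-patterns = fill-leaves⁻ I patterns

    I-auxInLA : All (λ ℓ → NoIneqAux (symbˡ ℓ)) (lits I)
    I-auxInLA = fill-lits⁻ I auxInLA

    -- The head literal contributes at most its own auxiliary variable, so every other symbol is
    -- already permitted by `C`.
    allowed : All (λ z → auxSym ι ≡ z ⊎ SharedOrAux C z) (symbⁱ (I [ leaf π ]))
    allowed = All.tabulate (narrow ∘ symbols)
      where
      narrow : ∀ {z} → SharedOrAux ((∼ ineq ι) ∷ C) z → auxSym ι ≡ z ⊎ SharedOrAux C z
      narrow (inj₁ z-shared) = inj₂ (inj₁ z-shared)
      narrow {z} (inj₂ (here z∈)) =
        inj₁ (auxOf-ineq ι (subst (λ ℓ → z ∈ auxOf ℓ) (∼-involutive (ineq ι)) z∈))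
      narrow (inj₂ (there any)) = inj₂ (inj₂ any)

    avoiding : ∀ {zs} → auxSym ι ∉ zs →
               All (λ z → auxSym ι ≡ z ⊎ SharedOrAux C z) zs → All (SharedOrAux C) zs
    avoiding x∉zs zs-ok = All.zipWith (λ { (≢z , inj₁ e) → contradiction e ≢z ; (_ , inj₂ ok) → ok })
      (All.¬Any⇒All¬ _ x∉zs , zs-ok)

    I-symbols : All (SharedOrAux C) (symbᶜ I)
    I-symbols = avoiding x∉I (fill-symbⁱ⁻ I {leaf π} allowed)

    private
      π-symbols : All (λ z → auxSym ι ≡ z ⊎ SharedOrAux C z) (symbᴸᴬ π)
      π-symbols = hole-symbᴸᴬ I I-hole allowed

    s-symbols : All (SharedOrAux C) (symbˢ s)
    s-symbols = avoiding x∉s (All.tail (All.++⁻ˡ (symbˢ (LA.s π)) π-symbols))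

    F-symbols : All (λ z → auxSym ι ≡ z ⊎ SharedOrAux C z) (symbᵖ F)
    F-symbols = All.++⁻ʳ (symbˢ (LA.s π)) π-symbols

    module _ (M : Structure) (ρ : Valuation M) where

      ρ[_] : Num ν → Valuation M
      ρ[ v ] = update M (num ν) ρ x v

      keep : ∀ {φ} v → All (auxSym ι ≢_) (symb φ) → holds M ρ φ → holds M ρ[ v ] φ
      keep {φ} v x∉φ = subst id (holds-cong M φ (All.map (λ {z} → update-agree M (num ν) ρ x v {z}) x∉φ))

      eval-part : ∀ {P : Monomial ν → Set} (P? : Decidable P) v →
                  evalˢ M ρ (filter P? lhs) ≡ evalˢ M ρ[ v ] (filter P? lhs)
      eval-part P? v = evalˢ-cong M (filter P? lhs) (symbˢ-filter P? lhs
        (update-agrees M (num ν) ρ x v (ι-free (ineqKey ι))))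

      project-pivot : ∀ {side v} → holds M ρ[ v ] (projectIneq side ι) →
                      holds M ρ[ v ] (project side (∼ ∼ ineq ι))
      project-pivot {side} {v} = subst (holds M ρ[ v ])
        (sym (trans (cong (project side) (∼-involutive (ineq ι))) (project-mixed side ι ι-mixed)))

      -- The value `-a` meets the projection `a + x ≤ 0` with equality, and by freshness neither `A`
      -- nor the other projected literals notice the change of `x`.
      A-implies : holds M ρ A → holds M ρ (negClause A-side C) →
                  holds M ρ[ -# evalˢ M ρ (A-part lhs) ] ⟪ I [ leaf π ] ⟫
      A-implies hA hC = implied M ρ[ v ]
        (keep {A} v (All.¬Any⇒All¬ _ (A-free (ineqKey ι))) hA ,
         project-pivot {A-side} (subst (_≤ᵇ 0ᵇ) (sym eval) (a-a≤ᵇ0 a)) ,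
         keep {negClause A-side C} v (auxSym∉negClause ι A-side C C-free ∼ι∉C) hC)
        where
        a v : Num ν
        a = evalˢ M ρ (A-part lhs)
        v = -# a
        eval : evalˢ M ρ[ v ] (A-part lhs ++ (1# , var x) ∷ []) ≡ a +# (1# *# v +# 0#)
        eval = trans (evalˢ-++ M ρ[ v ] (A-part lhs) _)
          (cong₂ (λ a v → a +# (1# *# v +# 0#)) (sym (eval-part _ v)) (update-same M (num ν) ρ x v))

      B-refutes : holds M ρ B → holds M ρ (negClause B-side C) →
                  ∀ v → (-# 1#) *# v +# evalˢ M ρ (rest lhs) ≤ᵇ Ineq.bound ι →
                  ¬ holds M ρ[ v ] ⟪ I [ leaf π ] ⟫
      B-refutes hB hC v ≤c h = inconsistent M ρ[ v ]
        ((keep {B} v (All.¬Any⇒All¬ _ (B-free (ineqKey ι))) hB ,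
          project-pivot {B-side} (subst (_≤ᵇ Ineq.bound ι) eval ≤c) ,
          keep {negClause B-side C} v (auxSym∉negClause ι B-side C C-free ∼ι∉C) hC) , h)
        where
        eval : (-# 1#) *# v +# evalˢ M ρ (rest lhs) ≡ evalˢ M ρ[ v ] ((-# 1# , var x) ∷ rest lhs)
        eval = cong₂ (λ v b → (-# 1#) *# v +# b) (sym (update-same M (num ν) ρ x v)) (eval-part _ v)

      fill-at : ∀ {χ χ′} v → (holds M ρ ⟪ χ ⟫ → holds M ρ[ v ] ⟪ χ′ ⟫) →
                holds M ρ ⟪ I [ χ ] ⟫ → holds M ρ[ v ] ⟪ I [ χ′ ] ⟫
      fill-at {χ} {χ′} v = fill-mono M I {χ} {χ′} (update-agrees M (num ν) ρ x v x∉I)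

      fill-from : ∀ {χ χ′} v → (holds M ρ[ v ] ⟪ χ ⟫ → holds M ρ ⟪ χ′ ⟫) →
                  holds M ρ[ v ] ⟪ I [ χ ] ⟫ → holds M ρ ⟪ I [ χ′ ] ⟫
      fill-from {χ} {χ′} v = fill-mono M I {χ} {χ′}
        (All.map (λ { {fun _} _ → tt ; {var _ _} → sym }) (update-agrees M (num ν) ρ x v x∉I))

      -- For a large enough value of the auxiliary variable ι↓B holds.
      B-refutes-unfilled : holds M ρ B → holds M ρ (negClause B-side C) →
                           ∀ {χ} → holds M ρ ⟪ I [ χ ] ⟫ → ¬ ¬ holds M ρ ⟪ χ ⟫
      B-refutes-unfilled hB hC {χ} h ¬hχ with ≤ᵇ-unbounded (evalˢ M ρ (rest lhs)) (Ineq.bound ι)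
      -- Since `χ` is false, the context holds whatever fills its hole, hence also with the pattern
      -- there.
      ... | v , ≤c = B-refutes hB hC v ≤c (fill-at {χ} {leaf π} v (λ hχ → contradiction hχ ¬hχ) h)

  negClause-++ : ∀ M ρ side C₁ {C₂} → holds M ρ (negClause side (C₁ ++ C₂)) →
                 holds M ρ (negClause side C₁) × holds M ρ (negClause side C₂)
  negClause-++ M ρ side []       h       = tt , h
  negClause-++ M ρ side (_ ∷ C₁) (h , t) = let (h₁ , h₂) = negClause-++ M ρ side C₁ t in (h , h₁) , h₂

  -- The resolution step.

  module Resolve {ν} (pivot : Ineq ν) (C₁ C₂ : Clause) (ℓ-mixed : Mixed (ineq pivot))
                 (A-free : AuxFree (symb A)) (B-free : AuxFree (symb B))
                 (free : All (AuxFree ∘ symbˡ) (ineq pivot ∷ C₁ ++ C₂))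
                 (ℓ∉C₁ : ineq pivot ∉ C₁) (∼ℓ∉C₂ : (∼ ineq pivot) ∉ C₂)
                 (I₁ I₂ : Context) (hole₁ : HasHole I₁) (hole₂ : HasHole I₂)
                 (c₁ c₂ : Num ν) (c₁>0 : Positive c₁) (c₂>0 : Positive c₂)
                 (s₁ s₂ : Lin ν) (k₁ k₂ : Slack ν) (F₁ F₂ : Plain)
                 (x₁∉I₁ : auxSym (negIneq pivot) ∉ symbᶜ I₁) (x₁∉s₁ : auxSym (negIneq pivot) ∉ symbˢ s₁)
                 (x₂∉I₂ : auxSym pivot ∉ symbᶜ I₂) (x₂∉s₂ : auxSym pivot ∉ symbˢ s₂)
                 (p₁ : IsPartialInterpolant (ineq pivot ∷ C₁)
                   (I₁ [ leaf (mkLA ((c₁ , var (aux (ineqKey (negIneq pivot)))) ∷ s₁) k₁ F₁) ]))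
                 (p₂ : IsPartialInterpolant ((∼ ineq pivot) ∷ C₂)
                   (I₂ [ leaf (mkLA ((c₂ , var (aux (ineqKey pivot))) ∷ s₂) k₂ F₂) ]))
                 where
    private
      ℓ-free : AuxFree (symbˡ (ineq pivot))
      ℓ-free = All.head free

      C-free = All.++⁻ C₁ (All.tail free)

      symbˡ-∼ℓ : symbˡ (∼ ineq pivot) ≡ symbˡ (ineq pivot)
      symbˡ-∼ℓ = symbˡ-∼ (ineq pivot)

      -- The role of `ι` is taken by the negated pivot, whose negation is the pivot only up to
      -- `∼-involutive`; hence the transports.
      module P₁ = Premise (negIneq pivot) C₁
        (trans (cong locality symbˡ-∼ℓ) ℓ-mixed)
        (subst (_∉ C₁) (sym (∼-involutive (ineq pivot))) ℓ∉C₁)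
        A-free B-free (subst AuxFree (sym symbˡ-∼ℓ) ℓ-free) (proj₁ C-free)
        I₁ hole₁ {c₁} {s₁} {k₁} {F₁} x₁∉I₁ x₁∉s₁
        (subst (λ ℓ → IsPartialInterpolant (ℓ ∷ C₁)
            (I₁ [ leaf (mkLA ((c₁ , var (aux (ineqKey (negIneq pivot)))) ∷ s₁) k₁ F₁) ]))
          (sym (∼-involutive (ineq pivot))) p₁)

      module P₂ = Premise pivot C₂ ℓ-mixed ∼ℓ∉C₂ A-free B-free ℓ-free (proj₂ C-free)
        I₂ hole₂ {c₂} {s₂} {k₂} {F₂} x₂∉I₂ x₂∉s₂ p₂

      open Resolvent (negIneq pivot) pivot c₁>0 c₂>0 P₁.isPattern P₂.isPattern x₁∉s₁ x₂∉s₂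

      I₃ : Interpolant
      I₃ = I₁ [ I₂ [ leaf π₃ ] ]

      -- Ties the two auxiliary variables together: the parts of the negated pivot are the negatives
      -- of those of the pivot, so the bounds on `x₁` and `x₂` are opposite.
      evalˢ-filter-neg : ∀ {P : List Sym → Set} (P? : Decidable P) M ρ →
        let s = Ineq.lhs pivot in
        evalˢ M ρ (filter (P? ∘ symbᵐ) ((-# 1#) · s)) ≡ (-# 1#) *# evalˢ M ρ (filter (P? ∘ symbᵐ) s)
      evalˢ-filter-neg P? M ρ = trans (cong (evalˢ M ρ) (filter-· P? (-# 1#) (Ineq.lhs pivot)))
        (evalˢ-· M ρ (-# 1#) (filter (P? ∘ symbᵐ) (Ineq.lhs pivot)))

      weaken₁ : ∀ {z} → SharedOrAux C₁ z → SharedOrAux (C₁ ++ C₂) z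
      weaken₁ = Sum.map₂ Any.++⁺ˡ

      weaken₂ : ∀ {z} → SharedOrAux C₂ z → SharedOrAux (C₁ ++ C₂) z
      weaken₂ = Sum.map₂ (Any.++⁺ʳ C₁)

      symbols₃ : All (SharedOrAux (C₁ ++ C₂)) (symbⁱ I₃)
      symbols₃ = fill-symbⁱ⁺ I₁ {I₂ [ leaf π₃ ]} (All.map weaken₁ P₁.I-symbols)
        (fill-symbⁱ⁺ I₂ {leaf π₃} (All.map weaken₂ P₂.I-symbols)
          (All.++⁺ (All.++⁺ (symbˢ-π₃ s₁-ok s₂-ok)
            (symbᵖ-F (All.map (Sum.map₂ weaken₁) P₁.F-symbols) (All.map (Sum.map₂ weaken₂) P₂.F-symbols)
              s₁-ok s₂-ok)) []))
        where
        s₁-ok = All.map weaken₁ P₁.s-symbols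
        s₂-ok = All.map weaken₂ P₂.s-symbols

    implied₃ : A ∧ᶠ negClause A-side (C₁ ++ C₂) ⊨ ⟪ I₃ ⟫
    implied₃ M ρ (hA , hC) =
      -- Each premise holds after a change of its own auxiliary variable. `fill-from` undoes the
      -- change outside the hole, so that `f₁` and `f₂` refer to the same `ρ`.
      P₁.fill-from M ρ {leaf P₁.π} {I₂ [ leaf π₃ ]} v (λ f₁ →
        P₂.fill-from M ρ {leaf P₂.π} {leaf π₃} _ (λ f₂ →
          split⇒F M ρ (split {point = v} f₁ (subst (At M ρ _ F₂) (cong -#_ a≡v) f₂)))
          (P₂.A-implies M ρ hA (proj₂ hCs)))
        (P₁.A-implies M ρ hA (proj₁ hCs))
      where
      hCs = negClause-++ M ρ A-side C₁ hC
      a v : Num ν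
      a = evalˢ M ρ (A-part (Ineq.lhs pivot))
      -- The value `P₁.A-implies` assigns to `x₁`: minus the `A`-local part of the negated pivot,
      -- which is `a` by cancelling signs.
      v = -# evalˢ M ρ (A-part ((-# 1#) · Ineq.lhs pivot))
      a≡v : a ≡ v
      a≡v = sym (trans (cong -#_ (evalˢ-filter-neg hasALocal? M ρ))
        (trans (sym (-1*≡- _)) (-1*-involutive a)))

    inconsistent₃ : (B ∧ᶠ negClause B-side (C₁ ++ C₂)) ∧ᶠ ⟪ I₃ ⟫ ⊨ ⊥ᶠ
    inconsistent₃ M ρ ((hB , hC) , h) =
      -- The goal is absurdity, so `I₂ [ leaf π₃ ]` and then `F₃` may be assumed although only their
      -- double negations are derived.
      P₁.B-refutes-unfilled M ρ hB (proj₁ hCs) {I₂ [ leaf π₃ ]} h λ h₂ →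
      P₂.B-refutes-unfilled M ρ hB (proj₂ hCs) {leaf π₃} h₂ λ hF →
      refute h₂ (F⇒split M ρ hF)
      where
      hCs = negClause-++ M ρ B-side C₁ hC
      refute : holds M ρ ⟪ I₂ [ leaf π₃ ] ⟫ → ¬ Split {ν} (At M ρ _ F₁) (At M ρ _ F₂)
      refute h₂ (split {v} f₁ f₂)
        with ≤ᵇ-dichotomy v (evalˢ M ρ (rest (Ineq.lhs pivot))) (Ineq.bound pivot)
      ... | inj₁ ≤c = P₂.B-refutes M ρ hB (proj₂ hCs) (-# v) ≤c
        -- The former content of the hole is dropped: `f₂` already makes the pattern true at the new
        -- value.
        (P₂.fill-at M ρ {leaf π₃} {leaf P₂.π} (-# v) (λ _ → f₂) h₂)
      ... | inj₂ >c = P₁.B-refutes M ρ hB (proj₁ hCs) v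
        (subst (λ b → (-# 1#) *# v +# b ≤ᵇ complement (Ineq.bound pivot))
          (sym (evalˢ-filter-neg (¬? ∘ hasALocal?) M ρ)) >c)
        (P₁.fill-at M ρ {I₂ [ leaf π₃ ]} {leaf P₁.π} v (λ _ → f₁) h)

    resolve : IsPartialInterpolant (C₁ ++ C₂) I₃
    resolve = record
      { implied      = implied₃
      ; inconsistent = inconsistent₃
      ; symbols      = All.lookup symbols₃
      ; patterns     = fill-leaves⁺ I₁ P₁.I-patterns (fill-leaves⁺ I₂ P₂.I-patterns (isPattern ∷ []))
      ; auxInLA      = fill-lits⁺ I₁ P₁.I-auxInLA (fill-lits⁺ I₂ P₂.I-auxInLA [])
      }

theorem3 :
  (S : Signature) → let open Logic S in
  (N : AuxNaming) (mode : SharedMode) (A B : Formula) →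
  let open Interpolation S N mode A B in
  InterpolationProblem →
  {ν : NumSort} (pivot : Ineq ν) (C₁ C₂ : Clause) →
  let ℓ  = ineq pivot
      x₁ = aux (ineqKey (negIneq pivot))
      x₂ = aux (ineqKey pivot)
  in
  Mixed ℓ →
  All Admissible (ℓ ∷ C₁ ++ C₂) →
  AuxFree (symb A) → AuxFree (symb B) →
  All (λ ℓ′ → AuxFree (symbˡ ℓ′)) (ℓ ∷ C₁ ++ C₂) →
  ℓ ∉ C₁ → (∼ ℓ) ∉ C₁ → ℓ ∉ C₂ → (∼ ℓ) ∉ C₂ →
  (I₁ I₂ : Context) → HasHole I₁ → HasHole I₂ →
  (c₁ c₂ : Num ν) (c₁>0 : Positive c₁) → Positive c₂ →
  (s₁ s₂ : Lin ν) (k₁ k₂ : Slack ν) (F₁ F₂ : Plain) →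
  Sym.var (num ν) x₁ ∉ symbᶜ I₁ → Sym.var (num ν) x₁ ∉ symbˢ s₁ →
  Sym.var (num ν) x₂ ∉ symbᶜ I₂ → Sym.var (num ν) x₂ ∉ symbˢ s₂ →
  IsPartialInterpolant (ℓ ∷ C₁)
    (I₁ [ leaf (mkLA ((c₁ , var x₁) ∷ s₁) k₁ F₁) ]) →
  IsPartialInterpolant ((∼ ℓ) ∷ C₂)
    (I₂ [ leaf (mkLA ((c₂ , var x₂) ∷ s₂) k₂ F₂) ]) →
  IsPartialInterpolant (C₁ ++ C₂)
    (I₁ [ I₂ [ leaf (mkLA
      (s₃ c₁ c₂ s₁ s₂)
      (k₃ c₁ c₂ k₁ k₂)
      (F₃ c₁ c₂ c₁>0 s₁ s₂ k₁ (λ t → F₁ ⟨ x₁ ≔ t ⟩) (λ t → F₂ ⟨ x₂ ≔ t ⟩))) ] ])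
theorem3 S N mode A B _ pivot C₁ C₂ ℓ-mixed _ A-free B-free free ℓ∉C₁ _ _ ∼ℓ∉C₂
  I₁ I₂ hole₁ hole₂ c₁ c₂ c₁>0 c₂>0 s₁ s₂ k₁ k₂ F₁ F₂ x₁∉I₁ x₁∉s₁ x₂∉I₂ x₂∉s₂ p₁ p₂ =
  Resolve.resolve pivot C₁ C₂ ℓ-mixed A-free B-free free ℓ∉C₁ ∼ℓ∉C₂ I₁ I₂ hole₁ hole₂
    c₁ c₂ c₁>0 c₂>0 s₁ s₂ k₁ k₂ F₁ F₂ x₁∉I₁ x₁∉s₁ x₂∉I₂ x₂∉s₂ p₁ p₂
  where open Resolution S N mode A B
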